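{- There is an absolute constant $C>0$ such that the following holds. Suppose that $k,N \in \mathbb{N}$ are such that there is a $k$-colouring of $\{1,\dots,N\}$ with no monochromatic solution to $x-y=z^2$, i.e. no $x,y,z\in\{1,\dots,N\}$ all of the same colour with $x-y=z^2$. Then $N\leq 2^{2^{2^{Ck}}}$.
   Context: A $k$-colouring of a set is a partition of it into at most $k$ colour classes. -}

module Defs where

open import Data.Nat using (ℕ; suc; _+_; _*_)
open import Data.Fin using (Fin; toℕ)
open import Relation.Binary.PropositionalEquality using (_≡_)
open import Data.Empty using (⊥)

-- The element i : Fin N represents the integer toℕ i + 1 ∈ {1,…,N}.
elt : ∀ {N} → Fin N → ℕ
elt i = suc (toℕ i)

-- A k-colouring of {1,…,N}: a map into k colours (classes may be empty,
-- so "at most k" classes).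
Colouring : ℕ → ℕ → Set
Colouring k N = Fin N → Fin k

NoMonoSquareDiff : ∀ {k N} → Colouring k N → Set
NoMonoSquareDiff {N = N} c =
  (x y z : Fin N) → elt x ≡ elt y + elt z * elt z →
  c x ≡ c y → c y ≡ c z → ⊥

{-# OPTIONS --safe #-}
-- Call a colour excluded for a set B of indices and a step q if, for every difference δ of B, q²δ is a
-- difference of two elements of that colour.  If d² is a difference of B, then q d has no excluded colour.
-- When no window of B with common difference V = w² is 3/2 times denser than B, a positive proportion of all
-- d has d² ∈ B - B: by van der Corput's inequality the function x ↦ |{d : x + d² ∈ B}| is close in L² to its
-- averages along progressions of step V, because V is a multiple of 2h for every shift h and
-- (d + h)² - d² is linear in d.  One colour c is popular on these q d, and intersecting its class with a
-- translate of B gives a new set, of density about the cube of the old one, for which c is excluded too.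
-- Otherwise pass to a denser window and replace q by q w; this happens O(log (1/density)) times per colour.
-- Once all colours are excluded there is a contradiction.  The densities stay above K⁻¹ with
-- log log K = O(k), so log V is polynomial in K, and each of the 2^O(k) steps takes roughly a square root
-- of the length; hence log log N = 2^O(k).
module Submission where

open import Defs

-- A density theorem for square differences would give x and y one colour, but z must have it too;
-- that is the obstacle. Excluding colours turns it around: B - B becomes a supply of differences
-- known to be realised in every excluded colour. Being excluded depends only on B - B, so it
-- survives translation, passage to subsets, and windows whose step is a perfect square, as q²w²δ =
-- (qw)²δ. This is why V = w²; the choice w = 2 · H! makes V divisible by every progression step
-- that differencing produces. Densities are fractions u/t with cleared denominators, and all sums
-- are integer sums. One exclusion replaces the inverse density K by 16kK², so it is squared up to a
-- factor, and k exclusions leave K at most 2^(2^O(k)). The numbers H and V and a bound Q for q are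
-- fixed in advance from the worst density, so that the required lengths do not depend on the course
-- of the descent. The set B is padded on the left by zeros so that every translation stays inside
-- ℕ.

module FiniteSums where

  open import Data.Nat.Base as ℕ using (ℕ; zero; suc; z≤n; s≤s)
  import Data.Nat.Properties as ℕ
  open import Data.Integer.Base hiding (suc; pred)
  open import Data.Integer.Properties
  open import Data.Integer.Tactic.RingSolver using (solve-∀)
  open import Data.Product using (∃; _×_; _,_)
  open import Data.Sum using (inj₁; inj₂)
  open import Relation.Binary.PropositionalEquality

  -- Order arithmetic in the integers.

  0≤+ : ∀ {n} → 0ℤ ≤ + n
  0≤+ = +≤+ z≤n

  0≤-+ : ∀ {a b} → 0ℤ ≤ a → 0ℤ ≤ b → 0ℤ ≤ a + b
  0≤-+ = +-mono-≤

  0≤-* : ∀ {a b} → 0ℤ ≤ a → 0ℤ ≤ b → 0ℤ ≤ a * b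
  0≤-* {+ a} {+ b} _ _ = subst (0ℤ ≤_) (pos-* a b) 0≤+

  0≤-² : ∀ a → 0ℤ ≤ a * a
  0≤-² (+ a) = 0≤-* {+ a} {+ a} 0≤+ 0≤+
  0≤-² -[1+ a ] = 0≤+

  -- Inequalities are proved by certificate: a visibly nonnegative `e`, and an identity that the
  -- ring solver checks.
  ≤-by : ∀ {a b} e → 0ℤ ≤ e → b ≡ a + e → a ≤ b
  ≤-by {a} e 0≤e refl = subst (_≤ a + e) (+-identityʳ a) (+-monoʳ-≤ a 0≤e)

  *-monoˡ : ∀ {a b} c → 0ℤ ≤ c → a ≤ b → c * a ≤ c * b
  *-monoˡ (+ c) _ a≤b = *-monoˡ-≤-nonNeg (+ c) a≤b

  *-monoʳ : ∀ {a b} c → 0ℤ ≤ c → a ≤ b → a * c ≤ b * c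
  *-monoʳ (+ c) _ a≤b = *-monoʳ-≤-nonNeg (+ c) a≤b

  *-mono : ∀ {a b c d} → 0ℤ ≤ a → 0ℤ ≤ d → a ≤ b → c ≤ d → a * c ≤ b * d
  *-mono {a} {b} {c} {d} 0≤a 0≤d a≤b c≤d = ≤-trans (*-monoˡ a 0≤a c≤d) (*-monoʳ d 0≤d a≤b)

  0<-* : ∀ {a b} → 0ℤ < a → 0ℤ < b → 0ℤ < a * b
  0<-* {+ suc a} {+ suc b} _ _ = +<+ (s≤s z≤n)
  0<-* {+ zero} (+<+ ()) _
  0<-* {+ suc a} {+ zero} _ (+<+ ())

  *-cancelˡ : ∀ {a b} c → 0ℤ < c → c * a ≤ c * b → a ≤ b
  *-cancelˡ {a} {b} c 0<c = *-cancelˡ-≤-pos a b c {{positive 0<c}}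

  +-congˡ : ∀ a {b c} → b ≡ c → a + b ≡ a + c
  +-congˡ a = cong (λ e → a + e)

  -- Finite sums over initial segments of ℕ.

  ∑ : ℕ → (ℕ → ℤ) → ℤ
  ∑ zero    f = 0ℤ
  ∑ (suc n) f = f 0 + ∑ n (λ i → f (suc i))

  ∑-cong : ∀ n {f g} → (∀ i → f i ≡ g i) → ∑ n f ≡ ∑ n g
  ∑-cong zero    eq = refl
  ∑-cong (suc n) eq = cong₂ _+_ (eq 0) (∑-cong n (λ i → eq (suc i)))

  ∑-mono : ∀ n {f g} → (∀ i → i ℕ.< n → f i ≤ g i) → ∑ n f ≤ ∑ n g
  ∑-mono zero    le = ≤-refl
  ∑-mono (suc n) le = +-mono-≤ (le 0 (s≤s z≤n)) (∑-mono n (λ i i<n → le (suc i) (s≤s i<n)))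

  ∑-+ : ∀ n f g → ∑ n (λ i → f i + g i) ≡ ∑ n f + ∑ n g
  ∑-+ zero    f g = refl
  ∑-+ (suc n) f g = trans (+-congˡ (f 0 + g 0) (∑-+ n _ _)) (lemma (f 0) (g 0) _ _)
    where
    lemma : ∀ a b c d → a + b + (c + d) ≡ a + c + (b + d)
    lemma = solve-∀

  ∑-*ˡ : ∀ n c f → ∑ n (λ i → c * f i) ≡ c * ∑ n f
  ∑-*ˡ zero    c f = sym (*-zeroʳ c)
  ∑-*ˡ (suc n) c f = trans (+-congˡ (c * f 0) (∑-*ˡ n c _)) (sym (*-distribˡ-+ c _ _))

  ∑-*ʳ : ∀ n c f → ∑ n (λ i → f i * c) ≡ ∑ n f * c
  ∑-*ʳ n c f = trans (∑-cong n (λ i → *-comm (f i) c)) (trans (∑-*ˡ n c f) (*-comm c _))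

  ∑-neg : ∀ n f → ∑ n (λ i → - f i) ≡ - ∑ n f
  ∑-neg zero    f = refl
  ∑-neg (suc n) f = trans (+-congˡ (- f 0) (∑-neg n _)) (sym (neg-distrib-+ (f 0) _))

  ∑-- : ∀ n f g → ∑ n (λ i → f i - g i) ≡ ∑ n f - ∑ n g
  ∑-- n f g = trans (∑-+ n f (λ i → - g i)) (+-congˡ (∑ n f) (∑-neg n g))

  ∑-const : ∀ n c → ∑ n (λ _ → c) ≡ + n * c
  ∑-const zero    c = sym (*-zeroˡ c)
  ∑-const (suc n) c = trans (+-congˡ c (∑-const n c)) (sym (suc-* (+ n) c))

  ∑-≤-const : ∀ n {c f} → (∀ i → i ℕ.< n → f i ≤ c) → ∑ n f ≤ + n * c
  ∑-≤-const n {c} le = subst (_ ≤_) (∑-const n c) (∑-mono n le)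

  ∑-cong< : ∀ n {φ ψ : ℕ → ℤ} → (∀ i → i ℕ.< n → φ i ≡ ψ i) → ∑ n φ ≡ ∑ n ψ
  ∑-cong< n eq = ≤-antisym (∑-mono n (λ i i<n → ≤-reflexive (eq i i<n)))
                           (∑-mono n (λ i i<n → ≤-reflexive (sym (eq i i<n))))

  ∑-zero : ∀ n {f} → (∀ i → i ℕ.< n → f i ≡ 0ℤ) → ∑ n f ≡ 0ℤ
  ∑-zero zero    eq = refl
  ∑-zero (suc n) eq = cong₂ _+_ (eq 0 (s≤s z≤n)) (∑-zero n (λ i i<n → eq (suc i) (s≤s i<n)))

  ∑-nonneg : ∀ n {f} → (∀ i → i ℕ.< n → 0ℤ ≤ f i) → 0ℤ ≤ ∑ n f
  ∑-nonneg zero    le = ≤-refl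
  ∑-nonneg (suc n) le = 0≤-+ (le 0 (s≤s z≤n)) (∑-nonneg n (λ i i<n → le (suc i) (s≤s i<n)))

  ∑-swap : ∀ m n (f : ℕ → ℕ → ℤ) →
           ∑ m (λ i → ∑ n (λ j → f i j)) ≡ ∑ n (λ j → ∑ m (λ i → f i j))
  ∑-swap zero    n f = sym (∑-zero n (λ _ _ → refl))
  ∑-swap (suc m) n f =
    trans (+-congˡ (∑ n (f 0)) (∑-swap m n _)) (sym (∑-+ n (f 0) _))

  ∑-split : ∀ m n f → ∑ (m ℕ.+ n) f ≡ ∑ m f + ∑ n (λ i → f (m ℕ.+ i))
  ∑-split zero    n f = sym (+-identityˡ _)
  ∑-split (suc m) n f =
    trans (+-congˡ (f 0) (∑-split m n _)) (sym (+-assoc (f 0) _ _))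

  -- Both boundary pieces vanish. This is the translation invariance used throughout; the zeros
  -- padded to the left of B exist to supply its first hypothesis.
  ∑-shift : ∀ n u {f} → (∀ x → x ℕ.< u → f x ≡ 0ℤ) → (∀ x → f (n ℕ.+ x) ≡ 0ℤ) →
            ∑ n (λ x → f (u ℕ.+ x)) ≡ ∑ n f
  ∑-shift n u {f} low high = begin
    ∑ n (λ x → f (u ℕ.+ x))                    ≡⟨ +-identityˡ _ ⟨
    0ℤ + ∑ n (λ x → f (u ℕ.+ x))               ≡⟨ cong (λ e → e + ∑ n (λ x → f (u ℕ.+ x))) (∑-zero u low) ⟨
    ∑ u f + ∑ n (λ x → f (u ℕ.+ x))            ≡⟨ ∑-split u n f ⟨
    ∑ (u ℕ.+ n) f                              ≡⟨ cong (λ k → ∑ k f) (ℕ.+-comm u n) ⟩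
    ∑ (n ℕ.+ u) f                              ≡⟨ ∑-split n u f ⟩
    ∑ n f + ∑ u (λ x → f (n ℕ.+ x))            ≡⟨ +-congˡ (∑ n f) (∑-zero u (λ x _ → high x)) ⟩
    ∑ n f + 0ℤ                                 ≡⟨ +-identityʳ _ ⟩
    ∑ n f                                      ∎
    where open ≡-Reasoning

  ∑-*-∑ : ∀ m n f g → ∑ m f * ∑ n g ≡ ∑ m (λ i → ∑ n (λ j → f i * g j))
  ∑-*-∑ m n f g = trans (sym (∑-*ʳ m (∑ n g) f)) (∑-cong m (λ i → sym (∑-*ˡ n (f i) g)))

  ∑-blocks : ∀ m n f → ∑ (m ℕ.* n) f ≡ ∑ m (λ i → ∑ n (λ j → f (i ℕ.* n ℕ.+ j)))
  ∑-blocks zero    n f = refl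
  ∑-blocks (suc m) n f = begin
    ∑ (n ℕ.+ m ℕ.* n) f                        ≡⟨ ∑-split n (m ℕ.* n) f ⟩
    ∑ n f + ∑ (m ℕ.* n) (λ i → f (n ℕ.+ i))    ≡⟨ +-congˡ (∑ n f) (∑-blocks m n _) ⟩
    ∑ n f + ∑ m (λ i → ∑ n (λ j → f (n ℕ.+ (i ℕ.* n ℕ.+ j))))
      ≡⟨ +-congˡ (∑ n f) (∑-cong m (λ i → ∑-cong n (λ j →
           cong f (sym (ℕ.+-assoc n (i ℕ.* n) j))))) ⟩
    ∑ n f + ∑ m (λ i → ∑ n (λ j → f (n ℕ.+ i ℕ.* n ℕ.+ j)))  ∎
    where open ≡-Reasoning

  -- Induction on Lagrange's identity: adding the term a raises the defect by the sum of the squares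
  -- (a - f i)².
  cauchy-schwarz : ∀ n f → ∑ n f * ∑ n f ≤ + n * ∑ n (λ i → f i * f i)
  cauchy-schwarz zero    f = ≤-refl
  cauchy-schwarz (suc n) f = ≤-by
    (∑ n (λ i → (a - f (suc i)) * (a - f (suc i))) + (+ n * q - s * s))
    (0≤-+ (∑-nonneg n (λ i _ → 0≤-² (a - f (suc i))))
          (i≤j⇒0≤j-i (cauchy-schwarz n (λ i → f (suc i)))))
    (trans (lemma a s q (+ n)) (cong (λ e → (a + s) * (a + s) + (e + (+ n * q - s * s))) (sym eq)))
    where
    a = f 0
    s = ∑ n (λ i → f (suc i))
    q = ∑ n (λ i → f (suc i) * f (suc i))
    lemma : ∀ a s q n → (1ℤ + n) * (a * a + q) ≡
            (a + s) * (a + s) + (n * (a * a) + (- + 2 * a * s + q) + (n * q - s * s))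
    lemma = solve-∀
    expand : ∀ a x → (a - x) * (a - x) ≡ a * a + (- + 2 * a * x + x * x)
    expand = solve-∀
    eq : ∑ n (λ i → (a - f (suc i)) * (a - f (suc i))) ≡ + n * (a * a) + (- + 2 * a * s + q)
    eq = trans (∑-cong n (λ i → expand a (f (suc i))))
         (trans (∑-+ n _ _) (cong₂ _+_ (∑-const n (a * a))
         (trans (∑-+ n _ _) (cong (_+ q) (∑-*ˡ n (- + 2 * a) _)))))

  -- Moving the range by `a` loses `a` terms at one end and gains `a` at the other, each in [0,1].
  -- The next lemma is the reverse comparison.
  ∑-shift-≤ : ∀ M a {f} → (∀ x → 0ℤ ≤ f x) → (∀ x → f x ≤ 1ℤ) →
              ∑ M (λ d → f (a ℕ.+ d)) ≤ ∑ M f + + a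
  ∑-shift-≤ M a {f} 0≤f f≤1 = begin
    ∑ M (λ d → f (a ℕ.+ d))            ≤⟨ ≤-by (∑ a f) (∑-nonneg a (λ i _ → 0≤f i)) (+-comm (∑ a f) _) ⟩
    ∑ a f + ∑ M (λ d → f (a ℕ.+ d))    ≡⟨ trans (sym (∑-split a M f)) (trans (cong (λ k → ∑ k f) (ℕ.+-comm a M)) (∑-split M a f)) ⟩
    ∑ M f + ∑ a (λ d → f (M ℕ.+ d))    ≤⟨ +-monoʳ-≤ (∑ M f) (∑-≤-const a (λ i _ → f≤1 (M ℕ.+ i))) ⟩
    ∑ M f + + a * 1ℤ                   ≡⟨ +-congˡ (∑ M f) (*-identityʳ (+ a)) ⟩
    ∑ M f + + a                        ∎
    where open ≤-Reasoning

  ∑-≤-shift : ∀ M a {f} → (∀ x → 0ℤ ≤ f x) → (∀ x → f x ≤ 1ℤ) →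
              ∑ M f ≤ ∑ M (λ d → f (a ℕ.+ d)) + + a
  ∑-≤-shift M a {f} 0≤f f≤1 = begin
    ∑ M f                              ≤⟨ ≤-by (∑ a (λ d → f (M ℕ.+ d))) (∑-nonneg a (λ i _ → 0≤f (M ℕ.+ i))) refl ⟩
    ∑ M f + ∑ a (λ d → f (M ℕ.+ d))    ≡⟨ trans (sym (∑-split M a f)) (trans (cong (λ k → ∑ k f) (ℕ.+-comm M a)) (∑-split a M f)) ⟩
    ∑ a f + ∑ M (λ d → f (a ℕ.+ d))    ≤⟨ +-monoˡ-≤ _ (∑-≤-const a (λ i _ → f≤1 i)) ⟩
    + a * 1ℤ + ∑ M (λ d → f (a ℕ.+ d)) ≡⟨ trans (+-comm (+ a * 1ℤ) _) (+-congˡ (∑ M (λ d → f (a ℕ.+ d))) (*-identityʳ (+ a))) ⟩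
    ∑ M (λ d → f (a ℕ.+ d)) + + a      ∎
    where open ≤-Reasoning

  pigeonhole : ∀ n (f : ℕ → ℤ) {c} → 0 ℕ.< n → c ≤ ∑ n f → ∃ λ i → i ℕ.< n × c ≤ + n * f i
  pigeonhole n f {c} 0<n c≤ = let i , i<n , le = max n 0<n f in
    i , i<n , ≤-trans c≤ (∑-≤-const n le)
    where
    max : ∀ n → 0 ℕ.< n → (f : ℕ → ℤ) → ∃ λ i → i ℕ.< n × (∀ j → j ℕ.< n → f j ≤ f i)
    max (suc zero) _ f = 0 , s≤s z≤n , λ { zero _ → ≤-refl ; (suc j) (s≤s ()) }
    max (suc (suc n)) _ f with max (suc n) (s≤s z≤n) (λ i → f (suc i))
    ... | i , i<n , le with ≤-total (f 0) (f (suc i))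
    ...   | inj₁ p = suc i , s≤s i<n , λ { zero _ → p ; (suc j) (s≤s j<n) → le j j<n }
    ...   | inj₂ p = 0 , s≤s z≤n , λ { zero _ → ≤-refl ; (suc j) (s≤s j<n) → ≤-trans (le j j<n) p }

  -- Meant for a row of a correlation matrix, where only the diagonal entry is large.
  ∑-≤-except : ∀ n k {a c} (f : ℕ → ℤ) → 0ℤ ≤ c → f k ≤ a + c →
               (∀ i → i ℕ.< n → i ≢ k → f i ≤ a) → ∑ n f ≤ + n * a + c
  ∑-≤-except zero k {a} {c} f 0≤c _ _ =
    subst (0ℤ ≤_) (sym (trans (cong (_+ c) (*-zeroˡ a)) (+-identityˡ c))) 0≤c
  ∑-≤-except (suc n) zero {a} {c} f _ f0≤ f≤ = begin
    f 0 + ∑ n (λ i → f (suc i))   ≤⟨ +-mono-≤ f0≤ (∑-≤-const n (λ i i<n → f≤ (suc i) (s≤s i<n) (λ ()))) ⟩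
    a + c + + n * a               ≡⟨ lemma a c (+ n) ⟩
    (1ℤ + + n) * a + c            ∎
    where
    open ≤-Reasoning
    lemma : ∀ a c n → a + c + n * a ≡ (1ℤ + n) * a + c
    lemma = solve-∀
  ∑-≤-except (suc n) (suc k) {a} {c} f 0≤c fk≤ f≤ = begin
    f 0 + ∑ n (λ i → f (suc i))
      ≤⟨ +-mono-≤ (f≤ 0 (s≤s z≤n) (λ ()))
           (∑-≤-except n k (λ i → f (suc i)) 0≤c fk≤
             (λ i i<n i≢k → f≤ (suc i) (s≤s i<n) (λ { refl → i≢k refl }))) ⟩
    a + (+ n * a + c)             ≡⟨ lemma a c (+ n) ⟩
    (1ℤ + + n) * a + c            ∎
    where
    open ≤-Reasoning
    lemma : ∀ a c n → a + (n * a + c) ≡ (1ℤ + n) * a + c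
    lemma = solve-∀

-- Indicator functions, translates and averaging arguments.

module Indicators where

  open import Data.Nat.Base as ℕ using (ℕ; zero; suc; s≤s)
  import Data.Nat.Properties as ℕ
  open import Data.Integer.Base hiding (suc; pred)
  open import Data.Integer.Properties
  open import Data.Bool.Base using (Bool; true; false; _∧_)
  open import Data.List.Base using (List; []; _∷_; length)
  open import Data.List.Membership.Propositional using (_∈_)
  open import Data.List.Relation.Unary.Any using (here; there)
  open import Data.Product using (∃; _×_; _,_)
  open import Data.Sum using (_⊎_; inj₁; inj₂)
  open import Relation.Nullary using (Dec; yes; no; does)
  open import Relation.Nullary.Decidable using (dec-true; dec-false)
  open import Relation.Binary.PropositionalEquality
  open FiniteSums

  𝟙 : Bool → ℤ
  𝟙 true  = 1ℤ
  𝟙 false = 0ℤ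

  0≤𝟙 : ∀ b → 0ℤ ≤ 𝟙 b
  0≤𝟙 true  = 0≤+
  0≤𝟙 false = 0≤+

  𝟙≤1 : ∀ b → 𝟙 b ≤ 1ℤ
  𝟙≤1 true  = ≤-refl
  𝟙≤1 false = 0≤+

  𝟙-∧ : ∀ a b → 𝟙 (a ∧ b) ≡ 𝟙 a * 𝟙 b
  𝟙-∧ true  b = sym (*-identityˡ (𝟙 b))
  𝟙-∧ false b = refl

  𝟙-mono : ∀ {a b} → (a ≡ true → b ≡ true) → 𝟙 a ≤ 𝟙 b
  𝟙-mono {true}  imp = ≤-reflexive (cong 𝟙 (sym (imp refl)))
  𝟙-mono {false} {b} _ = 0≤𝟙 b

  𝟙-positive : ∀ b → 0ℤ < 𝟙 b → b ≡ true
  𝟙-positive true _ = refl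
  𝟙-positive false (+<+ ())

  ∧-true : ∀ {a b} → a ∧ b ≡ true → a ≡ true × b ≡ true
  ∧-true {true} {true} _ = refl , refl

  does-true : ∀ {ℓ} {P : Set ℓ} (d : Dec P) → does d ≡ true → P
  does-true (yes p) _ = p

  true≢false : ∀ {A : Set} {b} → b ≡ true → b ≡ false → A
  true≢false refl ()

  -- The zeros on the left leave room: moving the set back by at most `v` pushes none of it below 0.
  shift : ℕ → (ℕ → Bool) → ℕ → Bool
  shift zero    B x       = B x
  shift (suc v) B zero    = false
  shift (suc v) B (suc x) = shift v B x

  shift-+ : ∀ v B x → shift v B (v ℕ.+ x) ≡ B x
  shift-+ zero    B x = refl
  shift-+ (suc v) B x = shift-+ v B x

  shift-low : ∀ v B x → x ℕ.< v → shift v B x ≡ false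
  shift-low (suc v) B zero    _         = refl
  shift-low (suc v) B (suc x) (s≤s x<v) = shift-low v B x x<v

  shift-true : ∀ v B x → shift v B x ≡ true → ∃ λ y → x ≡ v ℕ.+ y × B y ≡ true
  shift-true zero    B x       eq = x , refl , eq
  shift-true (suc v) B (suc x) eq with shift-true v B x eq
  ... | y , refl , By = y , refl , By

  ∑-shift-𝟙 : ∀ v L B → ∑ (v ℕ.+ L) (λ x → 𝟙 (shift v B x)) ≡ ∑ L (λ x → 𝟙 (B x))
  ∑-shift-𝟙 zero    L B = refl
  ∑-shift-𝟙 (suc v) L B = trans (+-identityˡ _) (∑-shift-𝟙 v L B)

  truncate : ℕ → (ℕ → Bool) → ℕ → Bool
  truncate n B i = does (i ℕ.<? n) ∧ B i

  truncate-high : ∀ n B x → truncate n B (n ℕ.+ x) ≡ false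
  truncate-high n B x = cong (_∧ B (n ℕ.+ x)) (dec-false (n ℕ.+ x ℕ.<? n) (ℕ.m+n≮m n x))

  truncate-true : ∀ n B {i} → truncate n B i ≡ true → i ℕ.< n × B i ≡ true
  truncate-true n B {i} eq with ∧-true {does (i ℕ.<? n)} eq
  ... | i<n , Bi = does-true (i ℕ.<? n) i<n , Bi

  ∑-truncate : ∀ n B → ∑ n (λ i → 𝟙 (truncate n B i)) ≡ ∑ n (λ i → 𝟙 (B i))
  ∑-truncate n B = ∑-cong< n (λ i i<n → cong (λ b → 𝟙 (b ∧ B i)) (dec-true (i ℕ.<? n) i<n))

  -- Windows that begin below the shift lose terms, so they are no denser than windows of B.
  window-shift : ∀ V v B n x → ∃ λ a →
    ∑ n (λ i → 𝟙 (shift v B (V ℕ.* i ℕ.+ x))) ≤ ∑ n (λ i → 𝟙 (B (V ℕ.* i ℕ.+ a)))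
  window-shift V v B n x with x ℕ.<? v
  ... | no x≮v = x ℕ.∸ v , ≤-reflexive (∑-cong n (λ i → cong 𝟙 (trans (cong (shift v B) (eq i)) (shift-+ v B _))))
    where
    eq : ∀ i → V ℕ.* i ℕ.+ x ≡ v ℕ.+ (V ℕ.* i ℕ.+ (x ℕ.∸ v))
    eq i = trans (cong (V ℕ.* i ℕ.+_) (sym (ℕ.m+[n∸m]≡n (ℕ.≮⇒≥ x≮v))))
      (trans (sym (ℕ.+-assoc (V ℕ.* i) v _)) (trans (cong (ℕ._+ (x ℕ.∸ v)) (ℕ.+-comm (V ℕ.* i) v)) (ℕ.+-assoc v _ _)))
  window-shift V v B zero x | yes x<v = 0 , ≤-refl
  window-shift V v B (suc n) x | yes x<v with window-shift V v B n (V ℕ.+ x)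
  ... | a , le = a , (begin
      𝟙 (shift v B (V ℕ.* 0 ℕ.+ x)) + ∑ n (λ i → 𝟙 (shift v B (V ℕ.* suc i ℕ.+ x)))
        ≡⟨ cong₂ _+_ (cong 𝟙 (trans (cong (λ k → shift v B (k ℕ.+ x)) (ℕ.*-zeroʳ V)) (shift-low v B x x<v)))
             (∑-cong n (λ i → cong (λ k → 𝟙 (shift v B k)) (eq i))) ⟩
      0ℤ + ∑ n (λ i → 𝟙 (shift v B (V ℕ.* i ℕ.+ (V ℕ.+ x))))
        ≡⟨ +-identityˡ _ ⟩
      ∑ n (λ i → 𝟙 (shift v B (V ℕ.* i ℕ.+ (V ℕ.+ x))))
        ≤⟨ le ⟩
      ∑ n b
        ≤⟨ ≤-by (∑ 1 (λ i → b (n ℕ.+ i))) (∑-nonneg 1 {λ i → b (n ℕ.+ i)} (λ i _ → 0≤𝟙 _))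
             (trans (cong (λ k → ∑ k b) (ℕ.+-comm 1 n)) (∑-split n 1 b)) ⟩
      ∑ (suc n) b ∎)
    where
    open ≤-Reasoning
    b : ℕ → ℤ
    b i = 𝟙 (B (V ℕ.* i ℕ.+ a))
    eq : ∀ i → V ℕ.* suc i ℕ.+ x ≡ V ℕ.* i ℕ.+ (V ℕ.+ x)
    eq i = trans (cong (ℕ._+ x) (trans (ℕ.*-suc V i) (ℕ.+-comm V (V ℕ.* i)))) (ℕ.+-assoc (V ℕ.* i) V x)

  -- Averaging over `v`: as `v` runs through [0,X), each `i` of A meets each element of B exactly
  -- once, because B starts only at `n` and so no element is passed over.
  intersect-translate : ∀ n X (A B : ℕ → Bool) → 0 ℕ.< X →
    (∀ x → x ℕ.< n → B x ≡ false) → (∀ x → B (X ℕ.+ x) ≡ false) →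
    ∃ λ v → ∑ n (λ i → 𝟙 (A i)) * ∑ X (λ x → 𝟙 (B x)) ≤ + X * ∑ n (λ i → 𝟙 (A i ∧ B (i ℕ.+ v)))
  intersect-translate n X A B 0<X low high =
    let v , _ , le = pigeonhole X (λ v → ∑ n (λ i → 𝟙 (A i ∧ B (i ℕ.+ v)))) 0<X (≤-reflexive (sym total)) in v , le
    where
    translate : ∀ i → i ℕ.< n → ∑ X (λ v → 𝟙 (A i ∧ B (i ℕ.+ v))) ≡ 𝟙 (A i) * ∑ X (λ x → 𝟙 (B x))
    translate i i<n = begin
      ∑ X (λ v → 𝟙 (A i ∧ B (i ℕ.+ v)))         ≡⟨ ∑-cong X (λ v → 𝟙-∧ (A i) _) ⟩
      ∑ X (λ v → 𝟙 (A i) * 𝟙 (B (i ℕ.+ v)))     ≡⟨ ∑-*ˡ X (𝟙 (A i)) _ ⟩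
      𝟙 (A i) * ∑ X (λ v → 𝟙 (B (i ℕ.+ v)))     ≡⟨ cong (𝟙 (A i) *_) (∑-shift X i
                                                      (λ x x<i → cong 𝟙 (low x (ℕ.<-trans x<i i<n)))
                                                      (λ x → cong 𝟙 (high x))) ⟩
      𝟙 (A i) * ∑ X (λ x → 𝟙 (B x))             ∎
      where open ≡-Reasoning
    total : ∑ X (λ v → ∑ n (λ i → 𝟙 (A i ∧ B (i ℕ.+ v)))) ≡ ∑ n (λ i → 𝟙 (A i)) * ∑ X (λ x → 𝟙 (B x))
    total = trans (∑-swap X n (λ v i → 𝟙 (A i ∧ B (i ℕ.+ v))))
      (trans (∑-cong< n translate)
             (∑-*ʳ n (∑ X (λ x → 𝟙 (B x))) (λ i → 𝟙 (A i))))

  -- Within one class modulo `q`, the numbers q(d + 1) differ by multiples of q², which is the form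
  -- of difference that an exclusion speaks of.
  residue-class : ∀ n q (A : ℕ → Bool) → 0 ℕ.< q → ∃ λ r → r ℕ.< q ×
    ∑ (n ℕ.* q) (λ d → 𝟙 (A d)) ≤ + q * ∑ n (λ i → 𝟙 (A (i ℕ.* q ℕ.+ r)))
  residue-class n q A 0<q = pigeonhole q (λ r → ∑ n (λ i → 𝟙 (A (i ℕ.* q ℕ.+ r)))) 0<q
    (≤-reflexive (trans (∑-blocks n q (λ d → 𝟙 (A d))) (∑-swap n q (λ i r → 𝟙 (A (i ℕ.* q ℕ.+ r))))))

  module _ {C : Set} where

    ∑ᴸ : List C → (C → ℤ) → ℤ
    ∑ᴸ []       F = 0ℤ
    ∑ᴸ (c ∷ cs) F = F c + ∑ᴸ cs F

    ∑ᴸ-nonneg : ∀ cs {F : C → ℤ} → (∀ c → 0ℤ ≤ F c) → 0ℤ ≤ ∑ᴸ cs F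
    ∑ᴸ-nonneg []       0≤F = ≤-refl
    ∑ᴸ-nonneg (c ∷ cs) 0≤F = 0≤-+ (0≤F c) (∑ᴸ-nonneg cs 0≤F)

    ∈-≤-∑ᴸ : ∀ {c} cs {F : C → ℤ} → (∀ c → 0ℤ ≤ F c) → c ∈ cs → F c ≤ ∑ᴸ cs F
    ∈-≤-∑ᴸ (c ∷ cs) {F} 0≤F (here refl) = ≤-by (∑ᴸ cs F) (∑ᴸ-nonneg cs 0≤F) refl
    ∈-≤-∑ᴸ (c ∷ cs) {F} 0≤F (there c∈) = ≤-trans (∈-≤-∑ᴸ cs 0≤F c∈) (≤-by (F c) (0≤F c) (+-comm (F c) _))

    ∑-∑ᴸ : ∀ n cs (F : ℕ → C → ℤ) → ∑ n (λ i → ∑ᴸ cs (F i)) ≡ ∑ᴸ cs (λ c → ∑ n (λ i → F i c))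
    ∑-∑ᴸ n []       F = ∑-zero n (λ _ _ → refl)
    ∑-∑ᴸ n (c ∷ cs) F = trans (∑-+ n _ _) (+-congˡ (∑ n (λ i → F i c)) (∑-∑ᴸ n cs F))

    maximum : ∀ c cs (F : C → ℤ) → ∃ λ m → m ∈ c ∷ cs × ∑ᴸ (c ∷ cs) F ≤ + length (c ∷ cs) * F m
    maximum c cs F = let m , m∈ , le = max c cs in m , m∈ , bound (c ∷ cs) le
      where
      max : ∀ c cs → ∃ λ m → m ∈ c ∷ cs × (∀ {a} → a ∈ c ∷ cs → F a ≤ F m)
      max c [] = c , here refl , λ { (here refl) → ≤-refl ; (there ()) }
      max c (c' ∷ cs) with max c' cs
      ... | m , m∈ , le with ≤-total (F c) (F m)
      ...   | inj₁ p = m , there m∈ , λ { (here refl) → p ; (there a∈) → le a∈ }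
      ...   | inj₂ p = c , here refl , λ { (here refl) → ≤-refl ; (there a∈) → ≤-trans (le a∈) p }
      bound : ∀ cs {x} → (∀ {a} → a ∈ cs → F a ≤ x) → ∑ᴸ cs F ≤ + length cs * x
      bound []       {x} le = ≤-reflexive (sym (*-zeroˡ x))
      bound (c ∷ cs) {x} le = subst (F c + ∑ᴸ cs F ≤_) (sym (suc-* (+ length cs) x))
        (+-mono-≤ (le (here refl)) (bound cs (λ a∈ → le (there a∈))))

    remove : ∀ {c} {cs : List C} → c ∈ cs → ∃ λ cs' → length cs ≡ suc (length cs') ×
             (∀ {a} → a ∈ cs → a ≡ c ⊎ a ∈ cs')
    remove {cs = c ∷ cs} (here refl) = cs , refl , λ { (here refl) → inj₁ refl ; (there a∈) → inj₂ a∈ }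
    remove {cs = c ∷ cs} (there c∈) with remove c∈
    ... | cs' , len , split = c ∷ cs' , cong suc len , λ
      { (here refl) → inj₂ (here refl)
      ; (there a∈) → Data.Sum.map₂ there (split a∈) }

-- Van der Corput differencing for shifts by squares.

module VanDerCorput where

  open import Data.Nat.Base as ℕ using (ℕ; zero; suc; z≤n; s≤s)
  import Data.Nat.Properties as ℕ
  import Data.Nat.Tactic.RingSolver as ℕ-Solver
  open import Data.Integer.Base hiding (suc; pred)
  open import Data.Integer.Properties
  open import Data.Integer.Tactic.RingSolver using (solve-∀)
  open import Data.Product using (∃; _×_; _,_; proj₁; proj₂)
  open import Relation.Binary.Definitions using (tri<; tri≈; tri>)
  open import Relation.Nullary using (contradiction)
  open import Relation.Binary.PropositionalEquality
  open FiniteSums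

  square : ℕ → ℕ
  square n = n ℕ.* n

  -- If the `a i` are pairwise within `c`, each is within `c` of their mean; both sides are
  -- multiplied by `ℓ` to stay integral.
  deviation : ∀ ℓ j (a : ℕ → ℤ) {c} → j ℕ.< ℓ →
              (∀ i i' → i ℕ.< ℓ → i' ℕ.< ℓ → a i ≤ a i' + c) →
              (+ ℓ * a j - ∑ ℓ a ≤ + ℓ * c) × (- (+ ℓ * c) ≤ + ℓ * a j - ∑ ℓ a)
  deviation ℓ j a {c} j<ℓ close =
    ≤-by (s + + ℓ * c - + ℓ * a j) (i≤j⇒0≤j-i upper) (lemma₁ (+ ℓ * a j) s (+ ℓ * c)) ,
    ≤-by (+ ℓ * (a j + c) - s) (i≤j⇒0≤j-i lower) (lemma₂ (+ ℓ) (a j) s c)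
    where
    s = ∑ ℓ a
    upper : + ℓ * a j ≤ s + + ℓ * c
    upper = begin
      + ℓ * a j            ≡⟨ ∑-const ℓ (a j) ⟨
      ∑ ℓ (λ _ → a j)      ≤⟨ ∑-mono ℓ (λ i i<ℓ → close j i j<ℓ i<ℓ) ⟩
      ∑ ℓ (λ i → a i + c)  ≡⟨ trans (∑-+ ℓ a (λ _ → c)) (+-congˡ s (∑-const ℓ c)) ⟩
      s + + ℓ * c          ∎
      where open ≤-Reasoning
    lower : s ≤ + ℓ * (a j + c)
    lower = ∑-≤-const ℓ (λ i i<ℓ → close i j i<ℓ j<ℓ)
    lemma₁ : ∀ x y z → z ≡ x - y + (y + z - x)
    lemma₁ = solve-∀
    lemma₂ : ∀ l a s c → l * a - s ≡ - (l * c) + (l * (a + c) - s)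
    lemma₂ = solve-∀

  -- Here `f` stands for the indicator of B moved right by `Y`, so it lives on [Y,X). The hypothesis
  -- `room` makes `Y` exceed every translation that occurs, so sums over [0,X) are translation
  -- invariant.
  module _
    (f : ℕ → ℤ) (0≤f : ∀ x → 0ℤ ≤ f x) (f≤1 : ∀ x → f x ≤ 1ℤ)
    (M H V ℓ X Y : ℕ)
    (low : ∀ x → x ℕ.< Y → f x ≡ 0ℤ) (high : ∀ x → f (X ℕ.+ x) ≡ 0ℤ)
    (room : square (M ℕ.+ H) ℕ.+ V ℕ.* ℓ ℕ.≤ Y)
    where

    mass : ℤ
    mass = ∑ X f

    mass≥0 : 0ℤ ≤ mass
    mass≥0 = ∑-nonneg X (λ x _ → 0≤f x)

    -- The root is split into a long variable `d` and a short shift `h`, as differencing requires;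
    -- `suc` rules out the square 0.
    offset : ℕ → ℕ → ℕ
    offset d h = square (suc (d ℕ.+ h))

    offset≤ : ∀ {d h} → d ℕ.< M → h ℕ.< H → offset d h ℕ.≤ square (M ℕ.+ H)
    offset≤ {d} {h} d<M h<H = ℕ.*-mono-≤ le le
      where
      le : suc (d ℕ.+ h) ℕ.≤ M ℕ.+ H
      le = ℕ.+-mono-≤ d<M (ℕ.<⇒≤ h<H)

    windowSum : ℕ → ℤ
    windowSum x = ∑ ℓ (λ i → f (V ℕ.* i ℕ.+ x))

    V*≤ : ∀ {i} → i ℕ.< ℓ → V ℕ.* i ℕ.≤ V ℕ.* ℓ
    V*≤ i<ℓ = ℕ.*-monoʳ-≤ V (ℕ.<⇒≤ i<ℓ)

    below : ∀ {i x} → i ℕ.< ℓ → x ℕ.< square (M ℕ.+ H) → f (V ℕ.* i ℕ.+ x) ≡ 0ℤ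
    below {i} {x} i<ℓ x< = low _ (ℕ.<-≤-trans
      (subst (ℕ._< square (M ℕ.+ H) ℕ.+ V ℕ.* ℓ) (ℕ.+-comm x (V ℕ.* i))
        (ℕ.+-mono-<-≤ x< (V*≤ i<ℓ))) room)

    above : ∀ v x → f (v ℕ.+ (X ℕ.+ x)) ≡ 0ℤ
    above v x = trans (cong f (lemma v X x)) (high (v ℕ.+ x))
      where
      lemma : ∀ v X x → v ℕ.+ (X ℕ.+ x) ≡ X ℕ.+ (v ℕ.+ x)
      lemma = ℕ-Solver.solve-∀

    V*≤Y : ∀ {i} → i ℕ.< ℓ → V ℕ.* i ℕ.≤ Y
    V*≤Y i<ℓ = ℕ.≤-trans (V*≤ i<ℓ) (ℕ.≤-trans (ℕ.m≤n+m _ _) room)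

    mass-shift : ∀ {i} → i ℕ.< ℓ → ∑ X (λ x → f (V ℕ.* i ℕ.+ x)) ≡ mass
    mass-shift i<ℓ = ∑-shift X _ (λ x x< → low x (ℕ.<-≤-trans x< (V*≤Y i<ℓ))) high

    windowSum≥0 : ∀ x → 0ℤ ≤ windowSum x
    windowSum≥0 x = ∑-nonneg ℓ (λ i _ → 0≤f _)

    windowSum≤ℓ : ∀ x → windowSum x ≤ + ℓ
    windowSum≤ℓ x = subst (windowSum x ≤_) (*-identityʳ (+ ℓ)) (∑-≤-const ℓ (λ i _ → f≤1 _))

    ∑-windowSum : ∑ X windowSum ≡ + ℓ * mass
    ∑-windowSum = begin
      ∑ X windowSum                               ≡⟨ ∑-swap X ℓ (λ x i → f (V ℕ.* i ℕ.+ x)) ⟩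
      ∑ ℓ (λ i → ∑ X (λ x → f (V ℕ.* i ℕ.+ x)))   ≡⟨ ∑-cong< ℓ (λ i → mass-shift) ⟩
      ∑ ℓ (λ _ → mass)                            ≡⟨ ∑-const ℓ mass ⟩
      + ℓ * mass                                  ∎
      where open ≡-Reasoning

    module Discrepancy
      (div : ∀ s → 0 ℕ.< s → s ℕ.< H → ∃ λ m → V ≡ 2 ℕ.* s ℕ.* m)
      (M-large : 2 ℕ.* H ℕ.* V ℕ.* ℓ ℕ.≤ M)
      (j : ℕ) (j<ℓ : j ℕ.< ℓ)
      where

      -- `gap` is `ℓ` times the deviation of `f`, at the `j`-th place of a window, from the mean
      -- over that window.
      main gap : ℕ → ℤ
      main x = + ℓ * f (V ℕ.* j ℕ.+ x)
      gap x = main x - windowSum x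

      main≥0 : ∀ x → 0ℤ ≤ main x
      main≥0 x = 0≤-* {+ ℓ} 0≤+ (0≤f _)

      main≤ℓ : ∀ x → main x ≤ + ℓ
      main≤ℓ x = subst (main x ≤_) (*-identityʳ (+ ℓ)) (*-monoˡ (+ ℓ) 0≤+ (f≤1 _))

      gap-low : ∀ x → x ℕ.< square (M ℕ.+ H) → gap x ≡ 0ℤ
      gap-low x x< = begin
        + ℓ * f (V ℕ.* j ℕ.+ x) - windowSum x
          ≡⟨ cong₂ (λ a b → + ℓ * a - b) (below j<ℓ x<) (∑-zero ℓ (λ i i<ℓ → below i<ℓ x<)) ⟩
        + ℓ * 0ℤ - 0ℤ
          ≡⟨ cong (_- 0ℤ) (*-zeroʳ (+ ℓ)) ⟩
        0ℤ ∎
        where open ≡-Reasoning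

      gap-high : ∀ x → gap (X ℕ.+ x) ≡ 0ℤ
      gap-high x = begin
        + ℓ * f (V ℕ.* j ℕ.+ (X ℕ.+ x)) - windowSum (X ℕ.+ x)
          ≡⟨ cong₂ (λ a b → + ℓ * a - b) (above (V ℕ.* j) x) (∑-zero ℓ (λ i _ → above (V ℕ.* i) x)) ⟩
        + ℓ * 0ℤ - 0ℤ
          ≡⟨ cong (_- 0ℤ) (*-zeroʳ (+ ℓ)) ⟩
        0ℤ ∎
        where open ≡-Reasoning

      ∑-main+window : ∑ X (λ x → main x + windowSum x) ≡ + 2 * + ℓ * mass
      ∑-main+window = begin
        ∑ X (λ x → main x + windowSum x)   ≡⟨ ∑-+ X main windowSum ⟩
        ∑ X main + ∑ X windowSum           ≡⟨ cong₂ _+_ (trans (∑-*ˡ X (+ ℓ) _) (cong (+ ℓ *_) (mass-shift j<ℓ))) ∑-windowSum ⟩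
        + ℓ * mass + + ℓ * mass            ≡⟨ lemma (+ ℓ) mass ⟩
        + 2 * + ℓ * mass                   ∎
        where
        open ≡-Reasoning
        lemma : ∀ l m → l * m + l * m ≡ + 2 * l * m
        lemma = solve-∀

      -- Since |gap| ≤ main + windowSum, a factor of size at most `c` costs `c` times that sum.
      -- Bounding `gap` in L¹ this way gives estimates proportional to `mass` and not to `X`, so no
      -- density is lost.
      gap*≤ : ∀ x {c G} → G ≤ c → - c ≤ G → gap x * G ≤ c * (main x + windowSum x)
      gap*≤ x {c} {G} G≤c -c≤G = ≤-by (main x * (c - G) + windowSum x * (c + G))
        (0≤-+ (0≤-* (main≥0 x) (i≤j⇒0≤j-i G≤c))
              (0≤-* (windowSum≥0 x) (subst (0ℤ ≤_) (lemma₁ c G) (i≤j⇒0≤j-i -c≤G))))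
        (lemma₂ (main x) (windowSum x) c G)
        where
        lemma₁ : ∀ c G → G - - c ≡ c + G
        lemma₁ = solve-∀
        lemma₂ : ∀ p n c G → c * (p + n) ≡ (p - n) * G + (p * (c - G) + n * (c + G))
        lemma₂ = solve-∀

      ∑-gap*≤ : ∀ c (G : ℕ → ℤ) → (∀ x → G x ≤ c) → (∀ x → - c ≤ G x) →
                ∑ X (λ x → gap x * G x) ≤ c * (+ 2 * + ℓ * mass)
      ∑-gap*≤ c G G≤c -c≤G = begin
        ∑ X (λ x → gap x * G x)                    ≤⟨ ∑-mono X (λ x _ → gap*≤ x (G≤c x) (-c≤G x)) ⟩
        ∑ X (λ x → c * (main x + windowSum x))     ≡⟨ trans (∑-*ˡ X c _) (cong (c *_) ∑-main+window) ⟩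
        c * (+ 2 * + ℓ * mass)                     ∎
        where open ≤-Reasoning

      correlation : ℕ → ℕ → ℤ
      correlation h h' = ∑ M (λ d → ∑ X (λ x → gap (offset d h ℕ.+ x) * gap (offset d h' ℕ.+ x)))

      correlation-diag : ∀ h → h ℕ.< H → correlation h h ≤ + M * (+ ℓ * (+ 2 * + ℓ * mass))
      correlation-diag h h<H = ∑-≤-const M λ d d<M → begin
        ∑ X (λ x → gap (offset d h ℕ.+ x) * gap (offset d h ℕ.+ x))
          ≡⟨ ∑-shift X (offset d h)
               (λ x x< → cong (λ e → e * gap x) (gap-low x (ℕ.<-≤-trans x< (offset≤ d<M h<H))))
               (λ x → cong (λ e → e * gap (X ℕ.+ x)) (gap-high x)) ⟩
        ∑ X (λ x → gap x * gap x)
          ≤⟨ ∑-gap*≤ (+ ℓ) gap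
               (λ x → ≤-by (+ ℓ - main x + windowSum x) (0≤-+ (i≤j⇒0≤j-i (main≤ℓ x)) (windowSum≥0 x)) (lemma₁ (main x) (windowSum x) (+ ℓ)))
               (λ x → ≤-by (main x + (+ ℓ - windowSum x)) (0≤-+ (main≥0 x) (i≤j⇒0≤j-i (windowSum≤ℓ x))) (lemma₂ (main x) (windowSum x) (+ ℓ))) ⟩
        + ℓ * (+ 2 * + ℓ * mass) ∎
        where
        open ≤-Reasoning
        lemma₁ : ∀ p n l → l ≡ p - n + (l - p + n)
        lemma₁ = solve-∀
        lemma₂ : ∀ p n l → p - n ≡ - l + (p + (l - n))
        lemma₂ = solve-∀

      -- Write V = 2sm. Translating by V·i then only moves the index `d` of a progression of step 2s
      -- by m·i, so all places of the window have nearly the same sum over `d`. Two comparisons with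
      -- the unmoved sum cost at most Vℓ each; the bound does not grow with `M`.
      progression-gap : ∀ s → 0 ℕ.< s → s ℕ.< H → ∀ r →
        let G = ∑ M (λ d → gap (2 ℕ.* s ℕ.* d ℕ.+ r)); c = + ℓ * + (2 ℕ.* (V ℕ.* ℓ)) in
        (G ≤ c) × (- c ≤ G)
      progression-gap s 0<s s<H r with div s 0<s s<H
      ... | m , V≡ = subst (λ G → (G ≤ c) × (- c ≤ G)) (sym eq) (deviation ℓ j part j<ℓ close)
        where
        c = + ℓ * + (2 ℕ.* (V ℕ.* ℓ))
        ψ : ℕ → ℤ
        ψ d = f (2 ℕ.* s ℕ.* d ℕ.+ r)
        part : ℕ → ℤ
        part i = ∑ M (λ d → ψ (m ℕ.* i ℕ.+ d))
        reindex : ∀ i d → f (V ℕ.* i ℕ.+ (2 ℕ.* s ℕ.* d ℕ.+ r)) ≡ ψ (m ℕ.* i ℕ.+ d)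
        reindex i d = cong f (trans (cong (λ v → v ℕ.* i ℕ.+ (2 ℕ.* s ℕ.* d ℕ.+ r)) V≡) (lemma s m i d r))
          where
          lemma : ∀ s m i d r → 2 ℕ.* s ℕ.* m ℕ.* i ℕ.+ (2 ℕ.* s ℕ.* d ℕ.+ r) ≡ 2 ℕ.* s ℕ.* (m ℕ.* i ℕ.+ d) ℕ.+ r
          lemma = ℕ-Solver.solve-∀
        eq : ∑ M (λ d → gap (2 ℕ.* s ℕ.* d ℕ.+ r)) ≡ + ℓ * part j - ∑ ℓ part
        eq = trans (∑-- M _ _) (cong₂ _-_
          (trans (∑-*ˡ M (+ ℓ) _) (cong (+ ℓ *_) (∑-cong M (reindex j))))
          (trans (∑-swap M ℓ (λ d i → f (V ℕ.* i ℕ.+ (2 ℕ.* s ℕ.* d ℕ.+ r)))) (∑-cong ℓ (λ i → ∑-cong M (reindex i)))))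
        m≤V : m ℕ.≤ V
        m≤V = subst (m ℕ.≤_) (sym V≡) (ℕ.m≤n*m m (2 ℕ.* s) {{ℕ.>-nonZero (ℕ.*-mono-≤ {1} {2} (s≤s z≤n) 0<s)}})
        m*i≤ : ∀ {i} → i ℕ.< ℓ → + (m ℕ.* i) ≤ + (V ℕ.* ℓ)
        m*i≤ i<ℓ = +≤+ (ℕ.*-mono-≤ m≤V (ℕ.<⇒≤ i<ℓ))
        close : ∀ i i' → i ℕ.< ℓ → i' ℕ.< ℓ → part i ≤ part i' + + (2 ℕ.* (V ℕ.* ℓ))
        close i i' i<ℓ i'<ℓ = begin
          part i                                       ≤⟨ ∑-shift-≤ M (m ℕ.* i) (λ d → 0≤f _) (λ d → f≤1 _) ⟩
          ∑ M ψ + + (m ℕ.* i)                          ≤⟨ +-mono-≤ (∑-≤-shift M (m ℕ.* i') (λ d → 0≤f _) (λ d → f≤1 _)) (m*i≤ i<ℓ) ⟩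
          part i' + + (m ℕ.* i') + + (V ℕ.* ℓ)         ≤⟨ +-monoˡ-≤ (+ (V ℕ.* ℓ)) (+-monoʳ-≤ (part i') (m*i≤ i'<ℓ)) ⟩
          part i' + + (V ℕ.* ℓ) + + (V ℕ.* ℓ)          ≡⟨ lemma (part i') (+ (V ℕ.* ℓ)) ⟩
          part i' + + 2 * + (V ℕ.* ℓ)                  ≡⟨ +-congˡ (part i') (sym (pos-* 2 (V ℕ.* ℓ))) ⟩
          part i' + + (2 ℕ.* (V ℕ.* ℓ))                ∎
          where
          open ≤-Reasoning
          lemma : ∀ p v → p + v + v ≡ p + + 2 * v
          lemma = solve-∀

      -- offset d h' - offset d h is linear in d, so the sum over d runs along a progression.
      correlation-< : ∀ h h' → h ℕ.< h' → h' ℕ.< H →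
                      correlation h h' ≤ + ℓ * + (2 ℕ.* (V ℕ.* ℓ)) * (+ 2 * + ℓ * mass)
      correlation-< h h' h<h' h'<H = begin
        ∑ M (λ d → ∑ X (λ x → gap (offset d h ℕ.+ x) * gap (offset d h' ℕ.+ x)))
          ≡⟨ ∑-cong< M translate ⟩
        ∑ M (λ d → ∑ X (λ x → gap x * gap (2 ℕ.* s ℕ.* d ℕ.+ (r ℕ.+ x))))
          ≡⟨ ∑-swap M X (λ d x → gap x * gap (2 ℕ.* s ℕ.* d ℕ.+ (r ℕ.+ x))) ⟩
        ∑ X (λ x → ∑ M (λ d → gap x * gap (2 ℕ.* s ℕ.* d ℕ.+ (r ℕ.+ x))))
          ≡⟨ ∑-cong X (λ x → ∑-*ˡ M (gap x) _) ⟩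
        ∑ X (λ x → gap x * ∑ M (λ d → gap (2 ℕ.* s ℕ.* d ℕ.+ (r ℕ.+ x))))
          ≤⟨ ∑-gap*≤ _ _ (λ x → proj₁ (progression-gap s 0<s s<H (r ℕ.+ x)))
                         (λ x → proj₂ (progression-gap s 0<s s<H (r ℕ.+ x))) ⟩
        + ℓ * + (2 ℕ.* (V ℕ.* ℓ)) * (+ 2 * + ℓ * mass) ∎
        where
        open ≤-Reasoning
        s = h' ℕ.∸ h
        r = s ℕ.* (2 ℕ.+ h ℕ.+ h ℕ.+ s)
        0<s : 0 ℕ.< s
        0<s = ℕ.m<n⇒0<n∸m h<h'
        s<H : s ℕ.< H
        s<H = ℕ.≤-<-trans (ℕ.m∸n≤m h' h) h'<H
        reindex : ∀ d x → offset d h' ℕ.+ x ≡ 2 ℕ.* s ℕ.* d ℕ.+ (r ℕ.+ (offset d h ℕ.+ x))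
        reindex d x = trans (cong (λ k → offset d k ℕ.+ x) (sym (ℕ.m+[n∸m]≡n (ℕ.<⇒≤ h<h')))) (lemma d h s x)
          where
          lemma : ∀ d h s x → (1 ℕ.+ (d ℕ.+ (h ℕ.+ s))) ℕ.* (1 ℕ.+ (d ℕ.+ (h ℕ.+ s))) ℕ.+ x ≡
            2 ℕ.* s ℕ.* d ℕ.+ (s ℕ.* (2 ℕ.+ h ℕ.+ h ℕ.+ s) ℕ.+ ((1 ℕ.+ (d ℕ.+ h)) ℕ.* (1 ℕ.+ (d ℕ.+ h)) ℕ.+ x))
          lemma = ℕ-Solver.solve-∀
        translate : ∀ d → d ℕ.< M →
          ∑ X (λ x → gap (offset d h ℕ.+ x) * gap (offset d h' ℕ.+ x)) ≡
          ∑ X (λ x → gap x * gap (2 ℕ.* s ℕ.* d ℕ.+ (r ℕ.+ x)))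
        translate d d<M = trans
          (∑-cong X (λ x → cong (λ k → gap (offset d h ℕ.+ x) * gap k) (reindex d x)))
          (∑-shift X (offset d h)
            (λ x x< → cong (λ e → e * gap (2 ℕ.* s ℕ.* d ℕ.+ (r ℕ.+ x)))
              (gap-low x (ℕ.<-≤-trans x< (offset≤ d<M (ℕ.<-trans h<h' h'<H)))))
            (λ x → cong (λ e → e * gap (2 ℕ.* s ℕ.* d ℕ.+ (r ℕ.+ (X ℕ.+ x)))) (gap-high x)))

      correlation-sym : ∀ h h' → correlation h h' ≡ correlation h' h
      correlation-sym h h' = ∑-cong M (λ d → ∑-cong X (λ x → *-comm (gap (offset d h ℕ.+ x)) _))

      gapSum : ℕ → ℤ
      gapSum x = ∑ M (λ d → ∑ H (λ h → gap (offset d h ℕ.+ x)))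

      -- Cauchy-Schwarz over `d`, then expansion over pairs (h, h'). By `M-large` the off-diagonal
      -- entries of a row together cost no more than the diagonal bound, so one factor `H` is saved
      -- against the H² of the trivial estimate.
      ∑-gapSum² : ∑ X (λ x → gapSum x * gapSum x) ≤
                  + 2 * + M * + ℓ * (+ 2 * + M * + ℓ) * + H * mass
      ∑-gapSum² = begin
        ∑ X (λ x → gapSum x * gapSum x)
          ≤⟨ ∑-mono X (λ x _ → cauchy-schwarz M (row x)) ⟩
        ∑ X (λ x → + M * ∑ M (λ d → row x d * row x d))
          ≡⟨ ∑-*ˡ X (+ M) _ ⟩
        + M * ∑ X (λ x → ∑ M (λ d → row x d * row x d))
          ≡⟨ cong (+ M *_) rearrange ⟩
        + M * ∑ H (λ h → ∑ H (λ h' → correlation h h'))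
          ≤⟨ *-monoˡ (+ M) 0≤+ (∑-≤-const H row-bound) ⟩
        + M * (+ H * (+ 2 * (+ M * (+ ℓ * (+ 2 * + ℓ * mass)))))
          ≡⟨ lemma (+ M) (+ H) (+ ℓ) mass ⟩
        + 2 * + M * + ℓ * (+ 2 * + M * + ℓ) * + H * mass ∎
        where
        open ≤-Reasoning
        row : ℕ → ℕ → ℤ
        row x d = ∑ H (λ h → gap (offset d h ℕ.+ x))
        term : ℕ → ℕ → ℕ → ℕ → ℤ
        term x d h h' = gap (offset d h ℕ.+ x) * gap (offset d h' ℕ.+ x)
        rearrange : ∑ X (λ x → ∑ M (λ d → row x d * row x d)) ≡ ∑ H (λ h → ∑ H (λ h' → correlation h h'))
        rearrange =
          trans (∑-swap X M _) (trans (∑-cong M (λ d →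
            trans (∑-cong X (λ x → ∑-*-∑ H H _ _))
            (trans (∑-swap X H (λ x h → ∑ H (term x d h)))
                   (∑-cong H (λ h → ∑-swap X H (λ x h' → term x d h h'))))))
          (trans (∑-swap M H (λ d h → ∑ H (λ h' → ∑ X (λ x → term x d h h'))))
                 (∑-cong H (λ h → ∑-swap M H (λ d h' → ∑ X (λ x → term x d h h'))))))
        lemma : ∀ M H l m → M * (H * (+ 2 * (M * (l * (+ 2 * l * m))))) ≡
                            + 2 * M * l * (+ 2 * M * l) * H * m
        lemma = solve-∀
        a = + ℓ * + (2 ℕ.* (V ℕ.* ℓ)) * (+ 2 * + ℓ * mass)
        c = + M * (+ ℓ * (+ 2 * + ℓ * mass))
        2ℓm≥0 : 0ℤ ≤ + 2 * + ℓ * mass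
        2ℓm≥0 = 0≤-* {+ 2 * + ℓ} (0≤-* {+ 2} {+ ℓ} 0≤+ 0≤+) mass≥0
        c≥0 : 0ℤ ≤ c
        c≥0 = 0≤-* {+ M} 0≤+ (0≤-* {+ ℓ} 0≤+ 2ℓm≥0)
        a≥0 : 0ℤ ≤ a
        a≥0 = 0≤-* (0≤-* {+ ℓ} {+ (2 ℕ.* (V ℕ.* ℓ))} 0≤+ 0≤+) 2ℓm≥0
        off : ∀ h h' → h ℕ.< H → h' ℕ.< H → h' ≢ h → correlation h h' ≤ a
        off h h' h<H h'<H h'≢h with ℕ.<-cmp h h'
        ... | tri< h<h' _ _ = correlation-< h h' h<h' h'<H
        ... | tri≈ _ h≡h' _ = contradiction (sym h≡h') h'≢h
        ... | tri> _ _ h'<h = subst (_≤ a) (correlation-sym h' h) (correlation-< h' h h'<h h<H)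
        H*a≤c : + H * a ≤ c
        H*a≤c = begin
          + H * a
            ≡⟨ lemma' (+ H) (+ ℓ) (+ (2 ℕ.* (V ℕ.* ℓ))) (+ 2 * + ℓ * mass) ⟩
          + H * + (2 ℕ.* (V ℕ.* ℓ)) * (+ ℓ * (+ 2 * + ℓ * mass))
            ≡⟨ cong (_* (+ ℓ * (+ 2 * + ℓ * mass))) (sym (pos-* H (2 ℕ.* (V ℕ.* ℓ)))) ⟩
          + (H ℕ.* (2 ℕ.* (V ℕ.* ℓ))) * (+ ℓ * (+ 2 * + ℓ * mass))
            ≤⟨ *-monoʳ (+ ℓ * (+ 2 * + ℓ * mass)) (0≤-* {+ ℓ} 0≤+ 2ℓm≥0)
                 (+≤+ (subst (ℕ._≤ M) (lemma'' H V ℓ) M-large)) ⟩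
          c ∎
          where
          lemma' : ∀ H l v m → H * (l * v * m) ≡ H * v * (l * m)
          lemma' = solve-∀
          lemma'' : ∀ H V l → 2 ℕ.* H ℕ.* V ℕ.* l ≡ H ℕ.* (2 ℕ.* (V ℕ.* l))
          lemma'' = ℕ-Solver.solve-∀
        row-bound : ∀ h → h ℕ.< H → ∑ H (correlation h) ≤ + 2 * c
        row-bound h h<H = begin
          ∑ H (correlation h)
            ≤⟨ ∑-≤-except H h (correlation h) c≥0
                 (≤-trans (correlation-diag h h<H) (≤-by a a≥0 (+-comm a c)))
                 (λ h' h'<H → off h h' h<H h'<H) ⟩
          + H * a + c    ≤⟨ +-monoˡ-≤ c H*a≤c ⟩
          c + c          ≡⟨ lemma' c ⟩
          + 2 * c        ∎
          where
          lemma' : ∀ c → c + c ≡ + 2 * c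
          lemma' = solve-∀

      -- `H` is a perfect square so that the bound of `∑-gapSum²` is λ'² · mass with an integer λ' =
      -- 2Mℓσ.
      module _ (σ : ℕ) (H≡σ² : H ≡ square σ) (0<M : 0 ℕ.< M) (0<ℓ : 0 ℕ.< ℓ) (0<σ : 0 ℕ.< σ) where

        -- AM–GM in the form (gapSum + λ' φ)² ≥ 0 replaces a second Cauchy–Schwarz inequality.
        gapSum-correlation : - (+ 2 * + M * + ℓ * + σ * mass) ≤ ∑ X (λ x → f (V ℕ.* j ℕ.+ x) * gapSum x)
        gapSum-correlation = *-cancelˡ (+ 2 * λ') (0<-* {+ 2} (+<+ (s≤s z≤n)) 0<λ') (begin
          + 2 * λ' * - (λ' * mass)
            ≡⟨ lemma₁ λ' mass ⟩
          - (λ' * λ' * mass) - λ' * λ' * mass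
            ≤⟨ +-monoˡ-≤ (- (λ' * λ' * mass)) (neg-mono-≤ (subst (∑ X (λ x → gapSum x * gapSum x) ≤_) bound≡ ∑-gapSum²)) ⟩
          - ∑ X (λ x → gapSum x * gapSum x) - λ' * λ' * mass
            ≡⟨ cong₂ _-_ (sym (∑-neg X _)) (sym (trans (∑-*ˡ X (λ' * λ') _) (cong (λ' * λ' *_) (mass-shift j<ℓ)))) ⟩
          ∑ X (λ x → - (gapSum x * gapSum x)) - ∑ X (λ x → λ' * λ' * φ x)
            ≡⟨ ∑-- X _ _ ⟨
          ∑ X (λ x → - (gapSum x * gapSum x) - λ' * λ' * φ x)
            ≤⟨ ∑-mono X (λ x _ → pointwise (gapSum x) (φ x) (0≤f _) (f≤1 _)) ⟩
          ∑ X (λ x → + 2 * λ' * (φ x * gapSum x))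
            ≡⟨ ∑-*ˡ X (+ 2 * λ') _ ⟩
          + 2 * λ' * ∑ X (λ x → φ x * gapSum x) ∎)
          where
          open ≤-Reasoning
          φ : ℕ → ℤ
          φ x = f (V ℕ.* j ℕ.+ x)
          λ' = + 2 * + M * + ℓ * + σ
          0<λ' : 0ℤ < λ'
          0<λ' = 0<-* {+ 2 * + M * + ℓ} (0<-* {+ 2 * + M} (0<-* {+ 2} (+<+ (s≤s z≤n)) (+<+ 0<M)) (+<+ 0<ℓ)) (+<+ 0<σ)
          lemma₁ : ∀ l m → + 2 * l * - (l * m) ≡ - (l * l * m) - l * l * m
          lemma₁ = solve-∀
          bound≡ : + 2 * + M * + ℓ * (+ 2 * + M * + ℓ) * + H * mass ≡ λ' * λ' * mass
          bound≡ = trans (cong (λ h → + 2 * + M * + ℓ * (+ 2 * + M * + ℓ) * h * mass)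
                           (trans (cong +_ H≡σ²) (pos-* σ σ)))
                         (lemma (+ 2 * + M * + ℓ) (+ σ) mass)
            where
            lemma : ∀ a s m → a * a * (s * s) * m ≡ a * s * (a * s) * m
            lemma = solve-∀
          pointwise : ∀ D p → 0ℤ ≤ p → p ≤ 1ℤ → - (D * D) - λ' * λ' * p ≤ + 2 * λ' * (p * D)
          pointwise D p 0≤p p≤1 = ≤-by ((D + λ' * p) * (D + λ' * p) + λ' * λ' * (p * (1ℤ - p)))
            (0≤-+ (0≤-² (D + λ' * p)) (0≤-* (0≤-² λ') (0≤-* 0≤p (i≤j⇒0≤j-i p≤1))))
            (lemma D λ' p)
            where
            lemma : ∀ D l p → + 2 * l * (p * D) ≡
              - (D * D) - l * l * p + ((D + l * p) * (D + l * p) + l * l * (p * (1ℤ - p)))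
            lemma = solve-∀

    squareShifts windowedSquareShifts : ℕ → ℤ
    squareShifts x = ∑ M (λ d → ∑ H (λ h → f (offset d h ℕ.+ x)))
    windowedSquareShifts x = ∑ M (λ d → ∑ H (λ h → windowSum (offset d h ℕ.+ x)))

    ∑-windowedSquareShifts : ∑ X windowedSquareShifts ≡ + M * (+ H * (+ ℓ * mass))
    ∑-windowedSquareShifts = begin
      ∑ X windowedSquareShifts
        ≡⟨ ∑-swap X M _ ⟩
      ∑ M (λ d → ∑ X (λ x → ∑ H (λ h → windowSum (offset d h ℕ.+ x))))
        ≡⟨ ∑-cong M (λ d → ∑-swap X H (λ x h → windowSum (offset d h ℕ.+ x))) ⟩
      ∑ M (λ d → ∑ H (λ h → ∑ X (λ x → windowSum (offset d h ℕ.+ x))))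
        ≡⟨ ∑-cong< M (λ d d<M → ∑-cong< H (λ h h<H → trans
             (∑-shift X (offset d h)
               (λ x x< → ∑-zero ℓ (λ i i<ℓ → below i<ℓ (ℕ.<-≤-trans x< (offset≤ d<M h<H))))
               (λ x → ∑-zero ℓ (λ i _ → above (V ℕ.* i) x)))
             ∑-windowSum)) ⟩
      ∑ M (λ d → ∑ H (λ h → + ℓ * mass))
        ≡⟨ trans (∑-cong M (λ d → ∑-const H (+ ℓ * mass))) (∑-const M _) ⟩
      + M * (+ H * (+ ℓ * mass)) ∎
      where open ≡-Reasoning

    pairs : ℤ
    pairs = ∑ X (λ x → f x * squareShifts x)

    -- A value e = d + h arises at most once for each of the `H` shifts, and each `x` contributes in
    -- proportion to `f x`. With ρ the indicator of the square differences, many pairs force many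
    -- distinct roots.
    pairs-≤ : (ρ : ℕ → ℤ) → (∀ e → 0ℤ ≤ ρ e) → (∀ x e → f x * f (square (suc e) ℕ.+ x) ≤ ρ e) →
              pairs ≤ mass * (+ H * ∑ (M ℕ.+ H) ρ)
    pairs-≤ ρ 0≤ρ f*f≤ρ = begin
      ∑ X (λ x → f x * squareShifts x)
        ≤⟨ ∑-mono X (λ x _ → bound x) ⟩
      ∑ X (λ x → f x * (+ H * ∑ (M ℕ.+ H) ρ))
        ≡⟨ ∑-*ʳ X (+ H * ∑ (M ℕ.+ H) ρ) f ⟩
      mass * (+ H * ∑ (M ℕ.+ H) ρ) ∎
      where
      open ≤-Reasoning
      -- Integrality makes `p` 0 or 1, so the factor `p` can be kept; without it the sum over `x`
      -- would cost `X` in place of `mass`.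
      p≤p*ρ : ∀ {p q r} → 0ℤ ≤ p → p ≤ 1ℤ → 0ℤ ≤ q → p * q ≤ r → p * q ≤ p * r
      p≤p*ρ {+ zero} {q} {r} _ _ _ _ = ≤-reflexive (trans (*-zeroˡ q) (sym (*-zeroˡ r)))
      p≤p*ρ {+ suc zero} {q} {r} _ _ _ le = subst (1ℤ * q ≤_) (sym (*-identityˡ r)) le
      p≤p*ρ {+ suc (suc p)} _ (+≤+ (s≤s ())) _ _
      bound : ∀ x → f x * squareShifts x ≤ f x * (+ H * ∑ (M ℕ.+ H) ρ)
      bound x = begin
        f x * squareShifts x
          ≡⟨ sym (trans (∑-cong M (λ d → ∑-*ˡ H (f x) _)) (∑-*ˡ M (f x) _)) ⟩
        ∑ M (λ d → ∑ H (λ h → f x * f (offset d h ℕ.+ x)))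
          ≤⟨ ∑-mono M (λ d _ → ∑-mono H (λ h _ →
               p≤p*ρ (0≤f x) (f≤1 x) (0≤f _) (f*f≤ρ x (d ℕ.+ h)))) ⟩
        ∑ M (λ d → ∑ H (λ h → f x * ρ (d ℕ.+ h)))
          ≡⟨ trans (∑-cong M (λ d → ∑-*ˡ H (f x) _)) (∑-*ˡ M (f x) _) ⟩
        f x * ∑ M (λ d → ∑ H (λ h → ρ (d ℕ.+ h)))
          ≡⟨ cong (f x *_) (∑-swap M H (λ d h → ρ (d ℕ.+ h))) ⟩
        f x * ∑ H (λ h → ∑ M (λ d → ρ (d ℕ.+ h)))
          ≤⟨ *-monoˡ (f x) (0≤f x) (∑-≤-const H column) ⟩
        f x * (+ H * ∑ (M ℕ.+ H) ρ) ∎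
        where
        column : ∀ h → h ℕ.< H → ∑ M (λ d → ρ (d ℕ.+ h)) ≤ ∑ (M ℕ.+ H) ρ
        column h h<H = begin
          ∑ M (λ d → ρ (d ℕ.+ h))
            ≡⟨ ∑-cong M (λ d → cong ρ (ℕ.+-comm d h)) ⟩
          ∑ M (λ d → ρ (h ℕ.+ d))
            ≤⟨ ≤-by (∑ h ρ) (∑-nonneg h (λ e _ → 0≤ρ e)) (trans (∑-split h M ρ) (+-comm (∑ h ρ) _)) ⟩
          ∑ (h ℕ.+ M) ρ
            ≤⟨ ≤-by _ (∑-nonneg (H ℕ.∸ h) (λ e _ → 0≤ρ (h ℕ.+ M ℕ.+ e)))
                 (trans (cong (λ n → ∑ n ρ) length≡) (∑-split (h ℕ.+ M) (H ℕ.∸ h) ρ)) ⟩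
          ∑ (M ℕ.+ H) ρ ∎
          where
          length≡ : M ℕ.+ H ≡ h ℕ.+ M ℕ.+ (H ℕ.∸ h)
          length≡ = trans (cong (M ℕ.+_) (sym (ℕ.m+[n∸m]≡n (ℕ.<⇒≤ h<H)))) (lemma M h (H ℕ.∸ h))
            where
            lemma : ∀ M h k → M ℕ.+ (h ℕ.+ k) ≡ h ℕ.+ M ℕ.+ k
            lemma = ℕ-Solver.solve-∀

    module Count
      (div : ∀ s → 0 ℕ.< s → s ℕ.< H → ∃ λ m → V ≡ 2 ℕ.* s ℕ.* m)
      (M-large : 2 ℕ.* H ℕ.* V ℕ.* ℓ ℕ.≤ M)
      (σ : ℕ) (H≡σ² : H ≡ square σ) (0<M : 0 ℕ.< M) (0<ℓ : 0 ℕ.< ℓ) (0<σ : 0 ℕ.< σ)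
      where

      open Discrepancy div M-large

      windowed : ℤ
      windowed = ∑ X (λ x → windowSum x * windowedSquareShifts x)

      pairs-shift : ∀ {j} → j ℕ.< ℓ →
        ∑ X (λ x → f (V ℕ.* j ℕ.+ x) * squareShifts (V ℕ.* j ℕ.+ x)) ≡ pairs
      pairs-shift {j} j<ℓ = ∑-shift X (V ℕ.* j)
        (λ x x< → cong (_* squareShifts x) (low x (ℕ.<-≤-trans x< (V*≤Y j<ℓ))))
        (λ x → cong (_* squareShifts (X ℕ.+ x)) (high x))

      gapSum-split : ∀ j j<ℓ x →
        gapSum j j<ℓ x ≡ + ℓ * squareShifts (V ℕ.* j ℕ.+ x) - windowedSquareShifts x
      gapSum-split j j<ℓ x = begin
        ∑ M (λ d → ∑ H (λ h → + ℓ * f (V ℕ.* j ℕ.+ (offset d h ℕ.+ x)) - windowSum (offset d h ℕ.+ x)))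
          ≡⟨ ∑-cong M (λ d → trans (∑-- H _ _) (cong (_- ∑ H (λ h → windowSum (offset d h ℕ.+ x)))
               (trans (∑-*ˡ H (+ ℓ) _) (cong (+ ℓ *_) (∑-cong H (λ h → cong f (lemma (V ℕ.* j) (offset d h) x))))))) ⟩
        ∑ M (λ d → + ℓ * ∑ H (λ h → f (offset d h ℕ.+ (V ℕ.* j ℕ.+ x))) - ∑ H (λ h → windowSum (offset d h ℕ.+ x)))
          ≡⟨ trans (∑-- M _ _) (cong (_- windowedSquareShifts x) (∑-*ˡ M (+ ℓ) _)) ⟩
        + ℓ * squareShifts (V ℕ.* j ℕ.+ x) - windowedSquareShifts x ∎
        where
        open ≡-Reasoning
        lemma : ∀ v u x → v ℕ.+ (u ℕ.+ x) ≡ u ℕ.+ (v ℕ.+ x)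
        lemma = ℕ-Solver.solve-∀

      -- Summed over the places `j` of the window, f(Vj + x) becomes `windowSum x`, while
      -- translation invariance gives the same `pairs` for each `j`. So both factors of `pairs` are
      -- replaced by window sums at the price of the correlation with `gapSum`.
      pairs-vs-windowed : windowed ≤ + ℓ * + ℓ * pairs + + ℓ * (+ 2 * + M * + ℓ * + σ * mass)
      pairs-vs-windowed = begin
        windowed
          ≡⟨ trans (∑-cong X (λ x → sym (∑-*ʳ ℓ (windowedSquareShifts x) _)))
               (∑-swap X ℓ (λ x j → f (V ℕ.* j ℕ.+ x) * windowedSquareShifts x)) ⟩
        ∑ ℓ (λ j → ∑ X (λ x → f (V ℕ.* j ℕ.+ x) * windowedSquareShifts x))
          ≤⟨ ∑-≤-const ℓ each ⟩
        + ℓ * (+ ℓ * pairs + + 2 * + M * + ℓ * + σ * mass)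
          ≡⟨ lemma (+ ℓ) pairs (+ 2 * + M * + ℓ * + σ * mass) ⟩
        + ℓ * + ℓ * pairs + + ℓ * (+ 2 * + M * + ℓ * + σ * mass) ∎
        where
        open ≤-Reasoning
        lemma : ∀ l p c → l * (l * p + c) ≡ l * l * p + l * c
        lemma = solve-∀
        each : ∀ j → j ℕ.< ℓ → ∑ X (λ x → f (V ℕ.* j ℕ.+ x) * windowedSquareShifts x) ≤
                               + ℓ * pairs + + 2 * + M * + ℓ * + σ * mass
        each j j<ℓ = ≤-by (e - - c)
          (i≤j⇒0≤j-i (subst (- c ≤_) e≡ (gapSum-correlation j j<ℓ σ H≡σ² 0<M 0<ℓ 0<σ)))
          (lemma' (+ ℓ * pairs) c (∑ X (λ x → f (V ℕ.* j ℕ.+ x) * windowedSquareShifts x)))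
          where
          c = + 2 * + M * + ℓ * + σ * mass
          e = + ℓ * pairs - ∑ X (λ x → f (V ℕ.* j ℕ.+ x) * windowedSquareShifts x)
          lemma' : ∀ p c w → p + c ≡ w + (p - w - - c)
          lemma' = solve-∀
          expand : ∀ p l s w → p * (l * s - w) ≡ l * (p * s) - p * w
          expand = solve-∀
          e≡ : ∑ X (λ x → f (V ℕ.* j ℕ.+ x) * gapSum j j<ℓ x) ≡ e
          e≡ = trans (∑-cong X (λ x → trans (cong (f (V ℕ.* j ℕ.+ x) *_) (gapSum-split j j<ℓ x))
                                     (expand (f (V ℕ.* j ℕ.+ x)) (+ ℓ) _ _)))
               (trans (∑-- X _ _) (cong (_- ∑ X (λ x → f (V ℕ.* j ℕ.+ x) * windowedSquareShifts x))
               (trans (∑-*ˡ X (+ ℓ) _) (cong (+ ℓ *_) (pairs-shift j<ℓ)))))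

      -- Both factors are at most 3/2 of their means, so summing (b - w)(bMH - s) ≥ 0 bounds their correlation
      -- below by 2 · 3/2 - (3/2)² = 3/4 of the product of the means.
      windowed-≥ : ∀ t u → 0 ℕ.< t →
        (∀ x → + 2 * + t * windowSum x ≤ + 3 * + u * + ℓ) →
        + 9 * + u * + X ≤ + 10 * + t * mass →
        + u * + ℓ * + ℓ * + M * + H * mass ≤ + 2 * + t * windowed
      windowed-≥ t u 0<t dense 9uX≤10tm = *-cancelˡ (+ 2 * + t) (0<-* {+ 2} (+<+ (s≤s z≤n)) (+<+ 0<t))
        (≤-by (∑ X (λ x → (b - w x) * (b * + M * + H - s x)) + + u * + ℓ * + ℓ * + M * + H * (+ 10 * + t * mass - + 9 * + u * + X))
          (0≤-+ (∑-nonneg X (λ x _ → 0≤-* (i≤j⇒0≤j-i (dense x)) (i≤j⇒0≤j-i (s≤ x))))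
                (0≤-* {+ u * + ℓ * + ℓ * + M * + H} uℓℓMH≥0 (i≤j⇒0≤j-i 9uX≤10tm)))
          (trans (lemma (+ t) (+ u) (+ ℓ) (+ M) (+ H) (+ X) mass windowed)
            (+-congˡ (+ 2 * + t * (+ u * + ℓ * + ℓ * + M * + H * mass)) (cong (_+ + u * + ℓ * + ℓ * + M * + H * (+ 10 * + t * mass - + 9 * + u * + X)) (sym expansion)))))
        where
        b = + 3 * + u * + ℓ
        w s : ℕ → ℤ
        w x = + 2 * + t * windowSum x
        s x = + 2 * + t * windowedSquareShifts x
        uℓℓMH≥0 : 0ℤ ≤ + u * + ℓ * + ℓ * + M * + H
        uℓℓMH≥0 = 0≤-* {+ u * + ℓ * + ℓ * + M} (0≤-* {+ u * + ℓ * + ℓ} (0≤-* {+ u * + ℓ} (0≤-* {+ u} {+ ℓ} 0≤+ 0≤+) 0≤+) 0≤+) 0≤+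
        s≤ : ∀ x → s x ≤ b * + M * + H
        s≤ x = begin
          + 2 * + t * ∑ M (λ d → ∑ H (λ h → windowSum (offset d h ℕ.+ x)))
            ≡⟨ sym (trans (∑-cong M (λ d → ∑-*ˡ H (+ 2 * + t) _)) (∑-*ˡ M (+ 2 * + t) _)) ⟩
          ∑ M (λ d → ∑ H (λ h → w (offset d h ℕ.+ x)))
            ≤⟨ ∑-≤-const M (λ d _ → ∑-≤-const H (λ h _ → dense (offset d h ℕ.+ x))) ⟩
          + M * (+ H * b)
            ≡⟨ lemma' (+ M) (+ H) b ⟩
          b * + M * + H ∎
          where
          open ≤-Reasoning
          lemma' : ∀ M H b → M * (H * b) ≡ b * M * H
          lemma' = solve-∀
        pointwise : ∀ t b M H w s → (b - + 2 * t * w) * (b * M * H - + 2 * t * s) ≡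
          b * b * M * H + (- (b * + 2 * t) * s + (- (b * M * H * + 2 * t) * w + + 4 * t * t * (w * s)))
        pointwise = solve-∀
        expansion : ∑ X (λ x → (b - w x) * (b * + M * + H - s x)) ≡
          + X * (b * b * + M * + H) + (- (b * + 2 * + t) * (+ M * (+ H * (+ ℓ * mass))) +
            (- (b * + M * + H * + 2 * + t) * (+ ℓ * mass) + + 4 * + t * + t * windowed))
        expansion = trans (∑-cong X (λ x → pointwise (+ t) b (+ M) (+ H) (windowSum x) (windowedSquareShifts x)))
          (trans (∑-+ X _ _) (cong₂ _+_ (∑-const X _)
          (trans (∑-+ X _ _) (cong₂ _+_ (trans (∑-*ˡ X (- (b * + 2 * + t)) _) (cong (- (b * + 2 * + t) *_) ∑-windowedSquareShifts))
          (trans (∑-+ X _ _) (cong₂ _+_ (trans (∑-*ˡ X (- (b * + M * + H * + 2 * + t)) _) (cong (- (b * + M * + H * + 2 * + t) *_) ∑-windowSum))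
          (∑-*ˡ X (+ 4 * + t * + t) _)))))))
        lemma : ∀ t u l M H X m W → + 2 * t * (+ 2 * t * W) ≡ + 2 * t * (u * l * l * M * H * m) +
          (X * (+ 3 * u * l * (+ 3 * u * l) * M * H) + (- (+ 3 * u * l * + 2 * t) * (M * (H * (l * m))) +
            (- (+ 3 * u * l * M * H * + 2 * t) * (l * m) + + 4 * t * t * W))
           + u * l * l * M * H * (+ 10 * t * m - + 9 * u * X))
        lemma = solve-∀

      -- The main term of `pairs` is at least (u/2t)·M·H·mass and the error is 2Mσ·mass. As H = σ²,
      -- the condition 8t ≤ uσ makes the error at most half of the main term; comparison with
      -- `pairs-≤` then cancels H·mass.
      square-differences-dense : ∀ t u (ρ : ℕ → ℤ) → 0 ℕ.< t →
        0ℤ < mass →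
        (∀ x → + 2 * + t * windowSum x ≤ + 3 * + u * + ℓ) →
        + 9 * + u * + X ≤ + 10 * + t * mass →
        + 8 * + t ≤ + u * + σ →
        (∀ e → 0ℤ ≤ ρ e) → (∀ x e → f x * f (square (suc e) ℕ.+ x) ≤ ρ e) →
        + u * + M ≤ + 4 * + t * ∑ (M ℕ.+ H) ρ
      square-differences-dense t u ρ 0<t 0<mass dense 9uX≤10tm 8t≤uσ 0≤ρ f*f≤ρ =
        *-cancelˡ (+ ℓ * + ℓ * + H * mass)
          (0<-* {+ ℓ * + ℓ * + H} (0<-* {+ ℓ * + ℓ} (0<-* {+ ℓ} (+<+ 0<ℓ) (+<+ 0<ℓ))
            (subst (λ h → 0ℤ < + h) (sym H≡σ²) (+<+ (ℕ.*-mono-≤ 0<σ 0<σ)))) 0<mass)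
          (≤-by (+ 2 * (+ 2 * + t * windowed - + u * + ℓ * + ℓ * + M * + H * mass)
              + + 4 * + t * (+ ℓ * + ℓ * pairs + + ℓ * (+ 2 * + M * + ℓ * + σ * mass) - windowed)
              + + 4 * + t * + ℓ * + ℓ * (mass * (+ H * R) - pairs)
              + + ℓ * + ℓ * + M * + σ * mass * (+ u * + σ - + 8 * + t))
            (0≤-+ (0≤-+ (0≤-+
              (0≤-* {+ 2} 0≤+ (i≤j⇒0≤j-i (windowed-≥ t u 0<t dense 9uX≤10tm)))
              (0≤-* {+ 4 * + t} (0≤-* {+ 4} {+ t} 0≤+ 0≤+) (i≤j⇒0≤j-i pairs-vs-windowed)))
              (0≤-* {+ 4 * + t * + ℓ * + ℓ} (0≤-* {+ 4 * + t * + ℓ} (0≤-* {+ 4 * + t} (0≤-* {+ 4} {+ t} 0≤+ 0≤+) 0≤+) 0≤+)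
                 (i≤j⇒0≤j-i (pairs-≤ ρ 0≤ρ f*f≤ρ))))
              (0≤-* {+ ℓ * + ℓ * + M * + σ * mass}
                 (0≤-* {+ ℓ * + ℓ * + M * + σ} (0≤-* {+ ℓ * + ℓ * + M} (0≤-* {+ ℓ * + ℓ} (0≤-* {+ ℓ} {+ ℓ} 0≤+ 0≤+) 0≤+) 0≤+) mass≥0)
                 (i≤j⇒0≤j-i 8t≤uσ)))
            (subst (λ h → + ℓ * + ℓ * h * mass * (+ 4 * + t * R) ≡ + ℓ * + ℓ * h * mass * (+ u * + M)
                + (+ 2 * (+ 2 * + t * windowed - + u * + ℓ * + ℓ * + M * h * mass)
                + + 4 * + t * (+ ℓ * + ℓ * pairs + + ℓ * (+ 2 * + M * + ℓ * + σ * mass) - windowed)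
                + + 4 * + t * + ℓ * + ℓ * (mass * (h * R) - pairs)
                + + ℓ * + ℓ * + M * + σ * mass * (+ u * + σ - + 8 * + t)))
              (sym (trans (cong +_ H≡σ²) (pos-* σ σ)))
              (lemma (+ ℓ) (+ σ) mass (+ t) (+ u) (+ M) R windowed pairs)))
        where
        R = ∑ (M ℕ.+ H) ρ
        lemma : ∀ l s m t u M R W P → l * l * (s * s) * m * (+ 4 * t * R) ≡ l * l * (s * s) * m * (u * M)
          + (+ 2 * (+ 2 * t * W - u * l * l * M * (s * s) * m)
          + + 4 * t * (l * l * P + l * (+ 2 * M * l * s * m) - W)
          + + 4 * t * l * l * (m * (s * s * R) - P)
          + l * l * M * s * m * (u * s - + 8 * t))
        lemma = solve-∀

-- Parameters of the descent and the loss of density.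

module Descent where

  open import Data.Nat.Base as ℕ using (ℕ; zero; suc; z≤n; s≤s; _!; _^_)
  import Data.Nat.Properties as ℕ
  import Data.Nat.Tactic.RingSolver as ℕ-Solver
  open import Data.Nat.Divisibility using (_∣_; m≤n⇒m!∣n!; ∣-trans; m∣m*n; quotient; m∣n⇒n≡quotient*m)
  open import Data.Integer.Base hiding (suc; pred; _^_)
  open import Data.Integer.Properties
  open import Data.Integer.Tactic.RingSolver using (solve-∀)
  open import Data.Bool.Base using (Bool; true; false; _∧_)
  import Data.Bool.Properties as Bool
  open import Data.Empty using (⊥; ⊥-elim)
  open import Data.Fin.Base using (Fin)
  import Data.Fin.Properties as Fin
  open import Data.List.Base using (List; []; _∷_; length)
  open import Data.List.Membership.Propositional using (_∈_)
  open import Data.Product using (∃; ∃₂; _×_; _,_; proj₁; proj₂)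
  open import Data.Sum using (_⊎_; inj₁; inj₂)
  open import Relation.Nullary using (Dec; yes; no; does)
  open import Relation.Nullary.Decidable using (dec-true)
  open import Relation.Binary.PropositionalEquality
  open FiniteSums
  open Indicators
  open VanDerCorput using (square; module Count)

  -- One factor 2·n! already gives the divisibility; the square is taken because windows may only
  -- have square steps.
  2s∣[2n!]² : ∀ n s → 0 ℕ.< s → s ℕ.< n → ∃ λ m → square (2 ℕ.* n !) ≡ 2 ℕ.* s ℕ.* m
  2s∣[2n!]² n (suc s) _ s<n = 2 ℕ.* k ℕ.* n ! , trans (cong (λ e → 2 ℕ.* e ℕ.* (2 ℕ.* n !)) eq) (lemma k (suc s) (n !))
    where
    s∣n! : suc s ∣ n !
    s∣n! = ∣-trans (m∣m*n (s !)) (m≤n⇒m!∣n! (ℕ.<⇒≤ s<n))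
    k = quotient s∣n!
    eq : n ! ≡ k ℕ.* suc s
    eq = m∣n⇒n≡quotient*m s∣n!
    lemma : ∀ k s f → 2 ℕ.* (k ℕ.* s) ℕ.* (2 ℕ.* f) ≡ 2 ℕ.* s ℕ.* (2 ℕ.* k ℕ.* f)
    lemma = ℕ-Solver.solve-∀

  -- The roots have R ≥ M/4K. One colour and one residue class modulo `q` keep a ≥ n/8kK of them,
  -- and B fills at least 1/2K of the padded range, since m ≥ L/K and X ≤ 2L. The product of the two
  -- proportions is 1/16kK².
  combine-densities : ∀ k K q t u L X M R a m n m' → 0ℤ < q → 0ℤ < u → 0ℤ < L →
    0ℤ ≤ k → 0ℤ ≤ K → 0ℤ ≤ a → 0ℤ ≤ R → 0ℤ ≤ m → 0ℤ ≤ m' →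
    u * M ≤ + 4 * t * R → t ≤ K * u → R ≤ k * (q * a) → a * m ≤ X * m' →
    u * L ≤ t * m → X ≤ + 2 * L → q * n ≤ + 2 * M → n ≤ + 16 * k * (K * K) * m'
  combine-densities k K q t u L X M R a m n m' 0<q 0<u 0<L 0≤k 0≤K 0≤a 0≤R 0≤m 0≤m' uM≤ t≤ R≤ am≤ uL≤ X≤ qn≤ =
    *-cancelˡ L 0<L (begin
      L * n
        ≤⟨ *-monoˡ L (<⇒≤ 0<L) n≤ ⟩
      L * (+ 8 * K * k * a)
        ≤⟨ *-monoʳ (+ 8 * K * k * a) (0≤-* {+ 8 * K * k} (0≤-* {+ 8 * K} (0≤-* {+ 8} 0≤+ 0≤K) 0≤k) 0≤a) L≤ ⟩
      K * m * (+ 8 * K * k * a)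
        ≡⟨ lemma₁ K m k a ⟩
      + 8 * k * (K * K) * (a * m)
        ≤⟨ *-monoˡ (+ 8 * k * (K * K)) 8kKK≥0 am≤ ⟩
      + 8 * k * (K * K) * (X * m')
        ≤⟨ *-monoˡ (+ 8 * k * (K * K)) 8kKK≥0 (*-monoʳ m' 0≤m' X≤) ⟩
      + 8 * k * (K * K) * (+ 2 * L * m')
        ≡⟨ lemma₂ k K L m' ⟩
      L * (+ 16 * k * (K * K) * m') ∎)
    where
    open ≤-Reasoning
    8kKK≥0 : 0ℤ ≤ + 8 * k * (K * K)
    8kKK≥0 = 0≤-* {+ 8 * k} (0≤-* {+ 8} 0≤+ 0≤k) (0≤-² K)
    lemma₁ : ∀ K m k a → K * m * (+ 8 * K * k * a) ≡ + 8 * k * (K * K) * (a * m)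
    lemma₁ = solve-∀
    lemma₂ : ∀ k K L m' → + 8 * k * (K * K) * (+ 2 * L * m') ≡ L * (+ 16 * k * (K * K) * m')
    lemma₂ = solve-∀
    L≤ : L ≤ K * m
    L≤ = *-cancelˡ u 0<u (≤-trans uL≤ (subst (t * m ≤_) (lemma K u m) (*-monoʳ m 0≤m t≤)))
      where
      lemma : ∀ K u m → K * u * m ≡ u * (K * m)
      lemma = solve-∀
    M≤ : M ≤ + 4 * K * R
    M≤ = *-cancelˡ u 0<u (≤-trans uM≤ (subst (+ 4 * t * R ≤_) (lemma K u R)
           (*-monoʳ R 0≤R (*-monoˡ (+ 4) 0≤+ t≤))))
      where
      lemma : ∀ K u R → + 4 * (K * u) * R ≡ u * (+ 4 * K * R)
      lemma = solve-∀
    n≤ : n ≤ + 8 * K * k * a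
    n≤ = *-cancelˡ q 0<q (begin
      q * n                              ≤⟨ qn≤ ⟩
      + 2 * M                            ≤⟨ *-monoˡ (+ 2) 0≤+ M≤ ⟩
      + 2 * (+ 4 * K * R)                ≤⟨ *-monoˡ (+ 2) 0≤+ (*-monoˡ (+ 4 * K) (0≤-* {+ 4} 0≤+ 0≤K) R≤) ⟩
      + 2 * (+ 4 * K * (k * (q * a)))    ≡⟨ lemma K k q a ⟩
      q * (+ 8 * K * k * a)              ∎)
      where
      lemma : ∀ K k q a → + 2 * (+ 4 * K * (k * (q * a))) ≡ q * (+ 8 * K * k * a)
      lemma = solve-∀

  nextInverseDensity : ℕ → ℕ → ℕ
  nextInverseDensity k K = 16 ℕ.* k ℕ.* square K

  -- The inverse density once `r` more colours have been excluded. Keeping this below K̂ lets one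
  -- choice of `H` and `V` serve the whole descent.
  finalInverseDensity : ℕ → ℕ → ℕ → ℕ
  finalInverseDensity k zero    K = K
  finalInverseDensity k (suc r) K = finalInverseDensity k r (nextInverseDensity k K)

  -- The square root σ = 8K is what 8t ≤ uσ asks for when t ≤ Ku.
  shifts dilation : ℕ → ℕ
  shifts K = square (8 ℕ.* K)
  dilation K = 2 ℕ.* shifts K !

  module _ (K Q : ℕ) where

    -- Length needed before a step that must leave length `ℓ`, with `q` replaced by its bound `Q`.
    -- The inner bracket bounds the padding Y. The factor 9 gives X = Y + L ≤ (10/9)L, which turns
    -- the 3 - 9/4 of the correlation bound into 3 - (9/4)(10/9) = 1/2.
    previousLength : ℕ → ℕ
    previousLength ℓ = 9 ℕ.* (square (2 ℕ.* H ℕ.* V ℕ.* ℓ ℕ.* Q ℕ.+ H) ℕ.+ V ℕ.* ℓ)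
      where
      H = shifts K
      V = square (dilation K)

    requiredLength : ℕ → ℕ
    requiredLength zero    = 1
    requiredLength (suc s) = previousLength (requiredLength s)

  -- The invariant and one step of the descent.

  module _
    (k N : ℕ) (0<k : 0 ℕ.< k) (χ : ℕ → Fin k)
    (avoid : ∀ y z → 0 ℕ.< y → 0 ℕ.< z → y ℕ.+ square z ℕ.≤ N →
             χ (y ℕ.+ square z) ≡ χ y → χ y ≡ χ z → ⊥)
    (K̂ E Q : ℕ) (0<K̂ : 0 ℕ.< K̂) (E-large : 2 ^ E ℕ.* K̂ ℕ.< 3 ^ E)
    where

    σ H w V : ℕ
    σ = 8 ℕ.* K̂
    H = shifts K̂
    w = dilation K̂
    V = square w

    0<σ : 0 ℕ.< σ
    0<σ = ℕ.*-mono-≤ {1} {8} (s≤s z≤n) 0<K̂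

    0<H : 0 ℕ.< H
    0<H = ℕ.*-mono-≤ 0<σ 0<σ

    0<w : 0 ℕ.< w
    0<w = ℕ.*-mono-≤ {1} {2} (s≤s z≤n) (ℕ.1≤n! H)

    0<V : 0 ℕ.< V
    0<V = ℕ.*-mono-≤ 0<w 0<w

    0<previousLength : ∀ ℓ → 0 ℕ.< previousLength K̂ Q ℓ
    0<previousLength ℓ = ℕ.*-mono-≤ {1} {9} (s≤s z≤n) (ℕ.≤-trans (ℕ.*-mono-≤ le le) (ℕ.m≤m+n _ _))
      where
      le : 1 ℕ.≤ 2 ℕ.* H ℕ.* V ℕ.* ℓ ℕ.* Q ℕ.+ H
      le = ℕ.≤-trans 0<H (ℕ.m≤n+m H _)

    0<requiredLength : ∀ s → 0 ℕ.< requiredLength K̂ Q s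
    0<requiredLength zero    = s≤s z≤n
    0<requiredLength (suc s) = 0<previousLength (requiredLength K̂ Q s)

    ≤-nextInverseDensity : ∀ K → 0 ℕ.< K → K ℕ.≤ nextInverseDensity k K
    ≤-nextInverseDensity K 0<K = begin
      K                          ≡⟨ ℕ.*-identityʳ K ⟨
      K ℕ.* 1                    ≤⟨ ℕ.*-monoʳ-≤ K 0<K ⟩
      K ℕ.* K                    ≡⟨ ℕ.*-identityˡ _ ⟨
      1 ℕ.* (K ℕ.* K)            ≤⟨ ℕ.*-monoˡ-≤ (K ℕ.* K) (ℕ.*-mono-≤ {1} {16} (s≤s z≤n) 0<k) ⟩
      nextInverseDensity k K       ∎
      where open ℕ.≤-Reasoning

    ≤-finalInverseDensity : ∀ r K → 0 ℕ.< K → K ℕ.≤ finalInverseDensity k r K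
    ≤-finalInverseDensity zero    K 0<K = ℕ.≤-refl
    ≤-finalInverseDensity (suc r) K 0<K =
      let le = ≤-nextInverseDensity K 0<K in
      ℕ.≤-trans le (≤-finalInverseDensity r _ (ℕ.≤-trans 0<K le))

    -- Only the difference δ enters the conclusion, so `y` need not come from `i`; this is what
    -- makes the property pass to translates and subsets. The bounds on `y` keep both points in
    -- {1,...,N}, where the colouring is meaningful.
    Excluded : ℕ → (ℕ → Bool) → Fin k → Set
    Excluded q B c = ∀ i δ → B i ≡ true → B (δ ℕ.+ i) ≡ true →
      ∃ λ y → 0 ℕ.< y × y ℕ.+ square q ℕ.* δ ℕ.≤ N × χ y ≡ c × χ (y ℕ.+ square q ℕ.* δ) ≡ c

    -- B ⊆ [0,L) has density at least u/t ≥ 1/K; s bounds the number of remaining steps and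
    -- e the number of density increments before the density would exceed 1.
    record State (s : ℕ) (cs : List (Fin k)) (e : ℕ) : Set where
      field
        q L K t u : ℕ
        B         : ℕ → Bool
        0<q       : 0 ℕ.< q
        0<t       : 0 ℕ.< t
        0<u       : 0 ℕ.< u
        inside    : square q ℕ.* L ℕ.≤ N
        support   : ∀ x → B (L ℕ.+ x) ≡ false
        dense     : + u * + L ≤ + t * ∑ L (λ x → 𝟙 (B x))
        t≤Ku      : t ℕ.≤ K ℕ.* u
        increments : 2 ^ e ℕ.* t ℕ.< 3 ^ e ℕ.* u
        K-bound   : finalInverseDensity k (length cs) K ℕ.≤ K̂
        colours   : ∀ c → c ∈ cs ⊎ Excluded q B c
        cs≤k      : length cs ℕ.≤ k
        long      : requiredLength K̂ Q s ℕ.≤ L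
        fine      : q ℕ.* w ^ s ℕ.≤ Q
        fuel      : length cs ℕ.* suc E ℕ.+ e ℕ.≤ s

      mass : ℤ
      mass = ∑ L (λ x → 𝟙 (B x))

      0<L : 0 ℕ.< L
      0<L = ℕ.≤-trans (0<requiredLength s) long

      mass≤L : mass ≤ + L
      mass≤L = subst (mass ≤_) (*-identityʳ (+ L)) (∑-≤-const L (λ x _ → 𝟙≤1 (B x)))

      mass≥0 : 0ℤ ≤ mass
      mass≥0 = ∑-nonneg L (λ x _ → 0≤𝟙 (B x))

      0<mass : 0ℤ < mass
      0<mass with 0ℤ <? mass
      ... | yes 0<m = 0<m
      ... | no  0≮m = ⊥-elim (<⇒≱ (0<-* {+ u} (+<+ 0<u) (+<+ 0<L))
              (≤-trans dense (≤-trans (*-monoˡ (+ t) 0≤+ (≮⇒≥ 0≮m)) (≤-reflexive (*-zeroʳ (+ t))))))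

      0<K : 0 ℕ.< K
      0<K with K in eq
      ... | zero  = ⊥-elim (ℕ.<⇒≱ 0<t (subst (λ K → t ℕ.≤ K ℕ.* u) eq t≤Ku))
      ... | suc _ = s≤s z≤n

      u≤t : u ℕ.≤ t
      u≤t = drop‿+≤+ (*-cancelˡ (+ L) (+<+ 0<L) (begin
        + L * + u      ≡⟨ *-comm (+ L) (+ u) ⟩
        + u * + L      ≤⟨ dense ⟩
        + t * mass     ≤⟨ *-monoˡ (+ t) 0≤+ mass≤L ⟩
        + t * + L      ≡⟨ *-comm (+ t) (+ L) ⟩
        + L * + t      ∎))
        where open ≤-Reasoning

    module Step {s cs e} (S : State (suc s) cs (suc e)) where
      open State S

      -- `M` carries the factor `q` because the roots will be split modulo `q`; about M/q of them,
      -- still at least `ℓ`, then index the new set. The summand `H` in `n` ensures M + H ≤ nq.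
      ℓ M Y n : ℕ
      ℓ = requiredLength K̂ Q s
      M = 2 ℕ.* H ℕ.* V ℕ.* ℓ ℕ.* q
      Y = square (M ℕ.+ H) ℕ.+ V ℕ.* ℓ
      n = 2 ℕ.* H ℕ.* V ℕ.* ℓ ℕ.+ H

      0<ℓ : 0 ℕ.< ℓ
      0<ℓ = 0<requiredLength s

      q≤Q : q ℕ.≤ Q
      q≤Q = ℕ.≤-trans (subst (ℕ._≤ q ℕ.* w ^ suc s) (ℕ.*-identityʳ q)
              (ℕ.*-monoʳ-≤ q (ℕ.m^n>0 w {{ℕ.>-nonZero 0<w}} (suc s)))) fine

      9Y≤L : 9 ℕ.* Y ℕ.≤ L
      9Y≤L = ℕ.≤-trans (ℕ.*-monoʳ-≤ 9 (ℕ.+-monoˡ-≤ (V ℕ.* ℓ) (ℕ.*-mono-≤ le le))) long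
        where
        le : M ℕ.+ H ℕ.≤ 2 ℕ.* H ℕ.* V ℕ.* ℓ ℕ.* Q ℕ.+ H
        le = ℕ.+-monoˡ-≤ H (ℕ.*-monoʳ-≤ (2 ℕ.* H ℕ.* V ℕ.* ℓ) q≤Q)

      Y≤L : Y ℕ.≤ L
      Y≤L = ℕ.≤-trans (ℕ.m≤n*m Y 9) 9Y≤L

      M+H≤Y : M ℕ.+ H ℕ.≤ Y
      M+H≤Y = ℕ.≤-trans (ℕ.m≤m*n (M ℕ.+ H) (M ℕ.+ H) {{ℕ.>-nonZero (ℕ.≤-trans 0<H (ℕ.m≤n+m H M))}}) (ℕ.m≤m+n _ _)

      Vℓ≤L : V ℕ.* ℓ ℕ.≤ L
      Vℓ≤L = ℕ.≤-trans (ℕ.m≤n+m _ _) Y≤L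

      n≤Y : n ℕ.≤ Y
      n≤Y = ℕ.≤-trans (ℕ.+-monoˡ-≤ H (ℕ.m≤m*n (2 ℕ.* H ℕ.* V ℕ.* ℓ) q {{ℕ.>-nonZero 0<q}})) M+H≤Y

      0<M : 0 ℕ.< M
      0<M = ℕ.*-mono-≤ (ℕ.*-mono-≤ (ℕ.*-mono-≤ (ℕ.*-mono-≤ {1} {2} (s≤s z≤n) 0<H) 0<V) 0<ℓ) 0<q

      window : ℕ → ℤ
      window a = ∑ ℓ (λ i → 𝟙 (B (V ℕ.* i ℕ.+ a)))

      -- A difference δ of window indices is a difference Vδ of B, and q²V = (qw)². The density
      -- bound u/t grows by 3/2, which uses up one unit of `e`.
      increment : ∀ a → + 3 * + u * + ℓ ≤ + 2 * + t * window a → State s cs e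
      increment a denser = record
        { q = q ℕ.* w ; L = ℓ ; K = K ; t = 2 ℕ.* t ; u = 3 ℕ.* u
        ; B = truncate ℓ B'
        ; 0<q = ℕ.*-mono-≤ 0<q 0<w
        ; 0<t = ℕ.*-mono-≤ {1} {2} (s≤s z≤n) 0<t
        ; 0<u = ℕ.*-mono-≤ {1} {3} (s≤s z≤n) 0<u
        ; inside = ℕ.≤-trans (subst (ℕ._≤ square q ℕ.* L) (lemma₁ q w ℓ) (ℕ.*-monoʳ-≤ (square q) Vℓ≤L)) inside
        ; support = truncate-high ℓ B'
        ; dense = subst₂ _≤_ (cong (_* + ℓ) (sym (pos-* 3 u)))
            (cong₂ _*_ (sym (pos-* 2 t)) (sym (∑-truncate ℓ B'))) denser
        ; t≤Ku = ℕ.≤-trans (ℕ.*-mono-≤ {2} {3} (s≤s (s≤s z≤n)) t≤Ku) (ℕ.≤-reflexive (lemma₂ K u))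
        ; increments = subst₂ ℕ._<_ (lemma₃ (2 ^ e) t) (lemma₄ (3 ^ e) u) increments
        ; K-bound = K-bound
        ; colours = λ c → Data.Sum.map₂ excluded (colours c)
        ; cs≤k = cs≤k
        ; long = ℕ.≤-refl
        ; fine = subst (ℕ._≤ Q) (sym (ℕ.*-assoc q w (w ^ s))) fine
        ; fuel = ℕ.≤-pred (subst (ℕ._≤ suc s) (ℕ.+-suc (length cs ℕ.* suc E) e) fuel)
        }
        where
        B' : ℕ → Bool
        B' i = B (V ℕ.* i ℕ.+ a)
        lemma₁ : ∀ q w l → q ℕ.* q ℕ.* (w ℕ.* w ℕ.* l) ≡ q ℕ.* w ℕ.* (q ℕ.* w) ℕ.* l
        lemma₁ = ℕ-Solver.solve-∀
        lemma₂ : ∀ K u → 3 ℕ.* (K ℕ.* u) ≡ K ℕ.* (3 ℕ.* u)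
        lemma₂ = ℕ-Solver.solve-∀
        lemma₃ : ∀ p t → 2 ℕ.* p ℕ.* t ≡ p ℕ.* (2 ℕ.* t)
        lemma₃ = ℕ-Solver.solve-∀
        lemma₄ : ∀ p t → 3 ℕ.* p ℕ.* t ≡ p ℕ.* (3 ℕ.* t)
        lemma₄ = ℕ-Solver.solve-∀
        excluded : ∀ {c} → Excluded q B c → Excluded (q ℕ.* w) (truncate ℓ B') c
        excluded {c} ex i δ Bi Bδi
          with ex (V ℕ.* i ℕ.+ a) (V ℕ.* δ) (proj₂ (truncate-true ℓ B' Bi))
                 (trans (cong B (trans (sym (ℕ.+-assoc (V ℕ.* δ) _ a)) (cong (ℕ._+ a) (sym (ℕ.*-distribˡ-+ V δ i)))))
                        (proj₂ (truncate-true ℓ B' Bδi)))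
        ... | y , 0<y , y≤ , χy , χy' = y , 0<y ,
              subst (λ d → y ℕ.+ d ℕ.≤ N) (lemma₁ q w δ) y≤ , χy ,
              subst (λ d → χ (y ℕ.+ d) ≡ c) (lemma₁ q w δ) χy'

      module Uniform (uniform : ∀ a → + 2 * + t * window a ≤ + 3 * + u * + ℓ) where

        X : ℕ
        X = Y ℕ.+ L

        B̂ : ℕ → Bool
        B̂ = shift Y B

        f : ℕ → ℤ
        f x = 𝟙 (B̂ x)

        -- Restricting the search to x < L, the support of B, makes membership of (e + 1)² in B - B
        -- decidable.
        difference? : ∀ e → Dec (∃ λ x → x ℕ.< L × B x ∧ B (square (suc e) ℕ.+ x) ≡ true)
        difference? e = ℕ.anyUpTo? (λ x → B x ∧ B (square (suc e) ℕ.+ x) Bool.≟ true) L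

        R : ℕ → Bool
        R e = does (difference? e)

        B-support : ∀ {x} → B x ≡ true → x ℕ.< L
        B-support {x} Bx with x ℕ.<? L
        ... | yes x<L = x<L
        ... | no  x≮L = true≢false Bx (trans (cong B (sym (ℕ.m+[n∸m]≡n (ℕ.≮⇒≥ x≮L)))) (support _))

        B̂-high : ∀ x → B̂ (X ℕ.+ x) ≡ false
        B̂-high x = trans (cong B̂ (ℕ.+-assoc Y L x)) (trans (shift-+ Y B (L ℕ.+ x)) (support x))

        f*f≤R : ∀ x e → f x * f (square (suc e) ℕ.+ x) ≤ 𝟙 (R e)
        f*f≤R x e = subst (_≤ 𝟙 (R e)) (𝟙-∧ (B̂ x) _) (𝟙-mono imp)
          where
          imp : B̂ x ∧ B̂ (square (suc e) ℕ.+ x) ≡ true → R e ≡ true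
          imp eq with ∧-true {B̂ x} eq
          ... | B̂x , B̂x' with shift-true Y B x B̂x
          ...   | y , refl , By = dec-true (difference? e) (y , B-support By ,
                    cong₂ _∧_ By (trans (sym (shift-+ Y B _)) (trans (cong B̂ (lemma Y (square (suc e)) y)) B̂x')))
            where
            lemma : ∀ Y z y → Y ℕ.+ (z ℕ.+ y) ≡ z ℕ.+ (Y ℕ.+ y)
            lemma = ℕ-Solver.solve-∀

        R-count : + u * + M ≤ + 4 * + t * ∑ (M ℕ.+ H) (λ e → 𝟙 (R e))
        R-count = Count.square-differences-dense f (λ x → 0≤𝟙 _) (λ x → 𝟙≤1 _) M H V ℓ X Y
          (λ x x<Y → cong 𝟙 (shift-low Y B x x<Y)) (λ x → cong 𝟙 (B̂-high x)) ℕ.≤-refl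
          (2s∣[2n!]² H) (ℕ.m≤m*n (2 ℕ.* H ℕ.* V ℕ.* ℓ) q {{ℕ.>-nonZero 0<q}})
          σ refl 0<M 0<ℓ 0<σ t u (λ e → 𝟙 (R e)) 0<t
          (subst (0ℤ <_) (sym (∑-shift-𝟙 Y L B)) 0<mass)
          windows 9uX≤10tm 8t≤uσ (λ e → 0≤𝟙 (R e)) f*f≤R
          where
          windows : ∀ x → + 2 * + t * ∑ ℓ (λ i → f (V ℕ.* i ℕ.+ x)) ≤ + 3 * + u * + ℓ
          windows x = let a , le = window-shift V Y B ℓ x in
            ≤-trans (*-monoˡ (+ 2 * + t) (0≤-* {+ 2} {+ t} 0≤+ 0≤+) le) (uniform a)
          9uX≤10tm : + 9 * + u * + X ≤ + 10 * + t * ∑ X f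
          9uX≤10tm = begin
            + 9 * + u * + X                              ≡⟨ lemma₁ (+ u) (+ Y) (+ L) ⟩
            + u * (+ 9 * + Y) + + 9 * (+ u * + L)        ≤⟨ +-monoˡ-≤ (+ 9 * (+ u * + L)) (*-monoˡ (+ u) 0≤+ (subst (_≤ + L) (pos-* 9 Y) (+≤+ 9Y≤L))) ⟩
            + u * + L + + 9 * (+ u * + L)                ≡⟨ lemma₂ (+ u * + L) ⟩
            + 10 * (+ u * + L)                           ≤⟨ *-monoˡ (+ 10) 0≤+ dense ⟩
            + 10 * (+ t * mass)                          ≡⟨ *-assoc (+ 10) (+ t) mass ⟨
            + 10 * + t * mass                            ≡⟨ cong (+ 10 * + t *_) (sym (∑-shift-𝟙 Y L B)) ⟩
            + 10 * + t * ∑ X f                           ∎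
            where
            open ≤-Reasoning
            lemma₁ : ∀ u y l → + 9 * u * (y + l) ≡ u * (+ 9 * y) + + 9 * (u * l)
            lemma₁ = solve-∀
            lemma₂ : ∀ x → x + + 9 * x ≡ + 10 * x
            lemma₂ = solve-∀
          8t≤uσ : + 8 * + t ≤ + u * + σ
          8t≤uσ = subst₂ _≤_ (pos-* 8 t) (pos-* u σ) (+≤+ (begin
            8 ℕ.* t              ≤⟨ ℕ.*-monoʳ-≤ 8 t≤Ku ⟩
            8 ℕ.* (K ℕ.* u)      ≤⟨ ℕ.*-monoʳ-≤ 8 (ℕ.*-monoˡ-≤ u (ℕ.≤-trans (≤-finalInverseDensity (length cs) K 0<K) K-bound)) ⟩
            8 ℕ.* (K̂ ℕ.* u)      ≡⟨ lemma K̂ u ⟩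
            u ℕ.* (8 ℕ.* K̂)      ∎))
            where
            open ℕ.≤-Reasoning
            lemma : ∀ K u → 8 ℕ.* (K ℕ.* u) ≡ u ℕ.* (8 ℕ.* K)
            lemma = ℕ-Solver.solve-∀

        coloured : Fin k → ℕ → Bool
        coloured c d = R d ∧ does (χ (q ℕ.* suc d) Fin.≟ c)

        -- Here the colouring hypothesis enters. Were the colour of q(d + 1) excluded, the
        -- difference (d + 1)² of B would yield `y` and y + (q(d + 1))² of that same colour, with
        -- the root as `z`.
        R-colour : ∀ d → R d ≡ true → χ (q ℕ.* suc d) ∈ cs
        R-colour d Rd with colours (χ (q ℕ.* suc d))
        ... | inj₁ c∈cs = c∈cs
        ... | inj₂ ex with does-true (difference? d) Rd
        ...   | x , _ , eq with ∧-true {B x} eq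
        ...     | Bx , Bx' with ex x (square (suc d)) Bx Bx'
        ...       | y , 0<y , y≤ , χy , χy' = ⊥-elim (avoid y (q ℕ.* suc d) 0<y (ℕ.*-mono-≤ 0<q (s≤s z≤n))
                      (subst (λ z → y ℕ.+ z ℕ.≤ N) eq² y≤)
                      (trans (subst (λ z → χ (y ℕ.+ z) ≡ χ (q ℕ.* suc d)) eq² χy') (sym χy)) χy)
          where
          eq² : square q ℕ.* square (suc d) ≡ square (q ℕ.* suc d)
          eq² = lemma q (suc d)
            where
            lemma : ∀ q d → q ℕ.* q ℕ.* (d ℕ.* d) ≡ q ℕ.* d ℕ.* (q ℕ.* d)
            lemma = ℕ-Solver.solve-∀

        count : Fin k → ℤ
        count c = ∑ (M ℕ.+ H) (λ d → 𝟙 (coloured c d))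

        R≤∑ᴸ : ∑ (M ℕ.+ H) (λ d → 𝟙 (R d)) ≤ ∑ᴸ cs count
        R≤∑ᴸ = subst (∑ (M ℕ.+ H) (λ d → 𝟙 (R d)) ≤_) (∑-∑ᴸ (M ℕ.+ H) cs (λ d c → 𝟙 (coloured c d)))
          (∑-mono (M ℕ.+ H) (λ d _ → each d))
          where
          each : ∀ d → 𝟙 (R d) ≤ ∑ᴸ cs (λ c → 𝟙 (coloured c d))
          each d with R d in Rd
          ... | false = ∑ᴸ-nonneg cs (λ _ → 0≤+)
          ... | true  = ≤-trans
            (≤-reflexive (sym (cong 𝟙 (dec-true (χ (q ℕ.* suc d) Fin.≟ _) refl))))
            (∈-≤-∑ᴸ cs (λ c → 0≤𝟙 _) (R-colour d Rd))

        module Exclude (c : Fin k) (c∈cs : c ∈ cs)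
          (popular : ∑ (M ℕ.+ H) (λ d → 𝟙 (R d)) ≤ + k * count c) where

          A : ℕ → Bool
          A = coloured c

          M+H≤nq : M ℕ.+ H ℕ.≤ n ℕ.* q
          M+H≤nq = subst (M ℕ.+ H ℕ.≤_) (sym (ℕ.*-distribʳ-+ q (2 ℕ.* H ℕ.* V ℕ.* ℓ) H))
            (ℕ.+-monoʳ-≤ M (ℕ.m≤m*n H q {{ℕ.>-nonZero 0<q}}))

          count≤ : count c ≤ ∑ (n ℕ.* q) (λ d → 𝟙 (A d))
          count≤ = ≤-by (∑ rest (λ d → 𝟙 (A (M ℕ.+ H ℕ.+ d))))
            (∑-nonneg rest (λ d _ → 0≤𝟙 (A (M ℕ.+ H ℕ.+ d))))
            (trans (cong (λ m → ∑ m (λ d → 𝟙 (A d))) (sym (ℕ.m+[n∸m]≡n M+H≤nq))) (∑-split (M ℕ.+ H) rest _))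
            where
            rest = n ℕ.* q ℕ.∸ (M ℕ.+ H)

          class = residue-class n q A 0<q

          r : ℕ
          r = proj₁ class

          r<q : r ℕ.< q
          r<q = proj₁ (proj₂ class)

          Aᵣ : ℕ → Bool
          Aᵣ i = A (i ℕ.* q ℕ.+ r)

          translate = intersect-translate n X Aᵣ B̂ (ℕ.≤-trans 0<L (ℕ.m≤n+m L Y))
            (λ x x<n → shift-low Y B x (ℕ.<-≤-trans x<n n≤Y)) B̂-high

          v : ℕ
          v = proj₁ translate

          -- The two factors have separate tasks: `Aᵣ` makes the popular colour excluded, and the
          -- translate of B preserves the earlier exclusions.
          B' : ℕ → Bool
          B' i = Aᵣ i ∧ B̂ (i ℕ.+ v)

          new-dense : + 1 * + n ≤ + nextInverseDensity k K * ∑ n (λ i → 𝟙 (truncate n B' i))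
          new-dense = subst₂ _≤_ (sym (*-identityˡ (+ n)))
            (cong₂ _*_ (sym cast) (sym (∑-truncate n B')))
            (combine-densities (+ k) (+ K) (+ q) (+ t) (+ u) (+ L) (+ X) (+ M)
              (∑ (M ℕ.+ H) (λ d → 𝟙 (R d))) (∑ n (λ i → 𝟙 (Aᵣ i))) mass (+ n) (∑ n (λ i → 𝟙 (B' i)))
              (+<+ 0<q) (+<+ 0<u) (+<+ 0<L) 0≤+ 0≤+
              (∑-nonneg n (λ i _ → 0≤𝟙 (Aᵣ i))) (∑-nonneg (M ℕ.+ H) (λ d _ → 0≤𝟙 (R d))) mass≥0
              (∑-nonneg n (λ i _ → 0≤𝟙 (B' i)))
              R-count
              (subst (+ t ≤_) (pos-* K u) (+≤+ t≤Ku))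
              (≤-trans popular (*-monoˡ (+ k) 0≤+ (≤-trans count≤ (proj₂ (proj₂ class)))))
              (subst (λ m → ∑ n (λ i → 𝟙 (Aᵣ i)) * m ≤ + X * ∑ n (λ i → 𝟙 (B' i))) (∑-shift-𝟙 Y L B) (proj₂ translate))
              dense
              (subst (+ X ≤_) (pos-* 2 L) (+≤+ (subst (X ℕ.≤_) (lemma₁ L) (ℕ.+-monoˡ-≤ L Y≤L))))
              (subst₂ _≤_ (pos-* q n) (pos-* 2 M) (+≤+ qn≤2M)))
            where
            lemma₁ : ∀ L → L ℕ.+ L ≡ 2 ℕ.* L
            lemma₁ = ℕ-Solver.solve-∀
            cast : + nextInverseDensity k K ≡ + 16 * + k * (+ K * + K)
            cast = trans (pos-* (16 ℕ.* k) (square K)) (cong₂ _*_ (pos-* 16 k) (pos-* K K))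
            qn≤2M : q ℕ.* n ℕ.≤ 2 ℕ.* M
            qn≤2M = begin
              q ℕ.* n                    ≡⟨ lemma₂ q (2 ℕ.* H ℕ.* V ℕ.* ℓ) H ⟩
              M ℕ.+ H ℕ.* q              ≤⟨ ℕ.+-monoʳ-≤ M (ℕ.*-monoˡ-≤ q H≤) ⟩
              M ℕ.+ M                    ≡⟨ lemma₁ M ⟩
              2 ℕ.* M                    ∎
              where
              open ℕ.≤-Reasoning
              lemma₂ : ∀ q a h → q ℕ.* (a ℕ.+ h) ≡ a ℕ.* q ℕ.+ h ℕ.* q
              lemma₂ = ℕ-Solver.solve-∀
              H≤ : H ℕ.≤ 2 ℕ.* H ℕ.* V ℕ.* ℓ
              H≤ = ℕ.≤-trans (ℕ.m≤n*m H 2) (ℕ.≤-trans (ℕ.m≤m*n (2 ℕ.* H) V {{ℕ.>-nonZero 0<V}})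
                     (ℕ.m≤m*n (2 ℕ.* H ℕ.* V) ℓ {{ℕ.>-nonZero 0<ℓ}}))

          inside' : square q ℕ.* n ℕ.≤ N
          inside' = ℕ.≤-trans (ℕ.*-monoʳ-≤ (square q) (ℕ.≤-trans n≤Y Y≤L)) inside

          -- The witness is the root q(iq + r + 1) itself: moving `i` by δ moves it by q²δ. Thus the
          -- values of z of one stage serve as x and y of the next.
          excluded-new : Excluded q (truncate n B') c
          excluded-new i δ Bi Bδi =
            let δi<n , B'δi = truncate-true n B' Bδi
                χi  = colour i (proj₂ (truncate-true n B' Bi))
                χδi = colour (δ ℕ.+ i) B'δi
            in element i , ℕ.*-mono-≤ 0<q (s≤s z≤n) ,
               subst (ℕ._≤ N) (element-shift i) (bound (δ ℕ.+ i) δi<n) ,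
               χi , subst (λ z → χ z ≡ c) (element-shift i) χδi
            where
            element : ℕ → ℕ
            element i = q ℕ.* suc (i ℕ.* q ℕ.+ r)
            colour : ∀ i → B' i ≡ true → χ (element i) ≡ c
            colour i B'i = does-true (χ (element i) Fin.≟ c)
              (proj₂ (∧-true {R (i ℕ.* q ℕ.+ r)} (proj₁ (∧-true {Aᵣ i} B'i))))
            element-shift : ∀ i → element (δ ℕ.+ i) ≡ element i ℕ.+ square q ℕ.* δ
            element-shift i = lemma q δ i r
              where
              lemma : ∀ q δ i r → q ℕ.* (1 ℕ.+ ((δ ℕ.+ i) ℕ.* q ℕ.+ r)) ≡ q ℕ.* (1 ℕ.+ (i ℕ.* q ℕ.+ r)) ℕ.+ q ℕ.* q ℕ.* δ
              lemma = ℕ-Solver.solve-∀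
            bound : ∀ i → i ℕ.< n → element i ℕ.≤ N
            bound i i<n = begin
              q ℕ.* suc (i ℕ.* q ℕ.+ r)    ≡⟨ cong (q ℕ.*_) (ℕ.+-suc (i ℕ.* q) r) ⟨
              q ℕ.* (i ℕ.* q ℕ.+ suc r)    ≤⟨ ℕ.*-monoʳ-≤ q (ℕ.+-monoʳ-≤ (i ℕ.* q) r<q) ⟩
              q ℕ.* (i ℕ.* q ℕ.+ q)        ≡⟨ lemma q i ⟩
              square q ℕ.* suc i           ≤⟨ ℕ.*-monoʳ-≤ (square q) i<n ⟩
              square q ℕ.* n               ≤⟨ inside' ⟩
              N                            ∎
              where
              open ℕ.≤-Reasoning
              lemma : ∀ q i → q ℕ.* (i ℕ.* q ℕ.+ q) ≡ q ℕ.* q ℕ.* (1 ℕ.+ i)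
              lemma = ℕ-Solver.solve-∀

          excluded-old : ∀ {a} → Excluded q B a → Excluded q (truncate n B') a
          excluded-old ex i δ Bi Bδi = ex x δ (proj₂ (proj₂ found))
            (trans (sym (shift-+ Y B (δ ℕ.+ x))) (trans (cong B̂ index)
              (proj₂ (∧-true {Aᵣ (δ ℕ.+ i)} (proj₂ (truncate-true n B' Bδi))))))
            where
            found : ∃ λ x → i ℕ.+ v ≡ Y ℕ.+ x × B x ≡ true
            found = shift-true Y B (i ℕ.+ v) (proj₂ (∧-true {Aᵣ i} (proj₂ (truncate-true n B' Bi))))
            x : ℕ
            x = proj₁ found
            lemma : ∀ Y δ x → Y ℕ.+ (δ ℕ.+ x) ≡ δ ℕ.+ (Y ℕ.+ x)
            lemma = ℕ-Solver.solve-∀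
            index : Y ℕ.+ (δ ℕ.+ x) ≡ δ ℕ.+ i ℕ.+ v
            index = trans (lemma Y δ x) (trans (cong (δ ℕ.+_) (sym (proj₁ (proj₂ found)))) (sym (ℕ.+-assoc δ i v)))

          next : ∃ λ cs' → State s cs' E
          next with remove c∈cs
          ... | cs' , len , split = cs' , record
            -- Only the guaranteed density 1/K' is recorded, and the count of increments starts
            -- again at `E`.
            { q = q ; L = n ; K = nextInverseDensity k K ; t = nextInverseDensity k K ; u = 1
            ; B = truncate n B'
            ; 0<q = 0<q
            ; 0<t = 0<K'
            ; 0<u = s≤s z≤n
            ; inside = inside'
            ; support = truncate-high n B'
            ; dense = new-dense
            ; t≤Ku = ℕ.≤-reflexive (sym (ℕ.*-identityʳ _))
            ; increments = subst (2 ^ E ℕ.* nextInverseDensity k K ℕ.<_) (sym (ℕ.*-identityʳ (3 ^ E)))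
                (ℕ.≤-<-trans (ℕ.*-monoʳ-≤ (2 ^ E) (ℕ.≤-trans (≤-finalInverseDensity (length cs') _ 0<K') K-bound')) E-large)
            ; K-bound = K-bound'
            ; colours = λ a → Data.Sum.[ (λ a∈ → Data.Sum.[ (λ { refl → inj₂ excluded-new }) , inj₁ ]′ (split a∈))
                                       , (λ ex → inj₂ (excluded-old ex)) ]′ (colours a)
            ; cs≤k = ℕ.≤-trans (ℕ.n≤1+n _) (subst (ℕ._≤ k) len cs≤k)
            ; long = ℕ.≤-trans ℓ≤ (ℕ.m≤m+n _ H)
            ; fine = ℕ.≤-trans (ℕ.*-monoʳ-≤ q (ℕ.m≤n*m (w ^ s) w {{ℕ.>-nonZero 0<w}})) fine
            -- A removed colour releases E + 1 units: one pays for this step and `E` for the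
            -- increments that may follow.
            ; fuel = ℕ.≤-pred (begin
                suc (length cs' ℕ.* suc E ℕ.+ E)       ≡⟨ lemma (length cs') E ⟩
                suc (length cs') ℕ.* suc E             ≡⟨ cong (ℕ._* suc E) len ⟨
                length cs ℕ.* suc E                    ≤⟨ ℕ.m≤m+n _ (suc e) ⟩
                length cs ℕ.* suc E ℕ.+ suc e          ≤⟨ fuel ⟩
                suc s                                  ∎)
            }
            where
            open ℕ.≤-Reasoning
            0<K' : 0 ℕ.< nextInverseDensity k K
            0<K' = ℕ.≤-trans 0<K (≤-nextInverseDensity K 0<K)
            K-bound' : finalInverseDensity k (length cs') (nextInverseDensity k K) ℕ.≤ K̂
            K-bound' = subst (λ r → finalInverseDensity k r K ℕ.≤ K̂) len K-bound
            lemma : ∀ r E → 1 ℕ.+ (r ℕ.* (1 ℕ.+ E) ℕ.+ E) ≡ (1 ℕ.+ r) ℕ.* (1 ℕ.+ E)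
            lemma = ℕ-Solver.solve-∀
            ℓ≤ : ℓ ℕ.≤ 2 ℕ.* H ℕ.* V ℕ.* ℓ
            ℓ≤ = ℕ.m≤n*m ℓ (2 ℕ.* H ℕ.* V) {{ℕ.>-nonZero (ℕ.*-mono-≤ (ℕ.*-mono-≤ {1} {2} (s≤s z≤n) 0<H) 0<V)}}

        popular-colour : ∃ λ c → c ∈ cs × ∑ (M ℕ.+ H) (λ d → 𝟙 (R d)) ≤ + k * count c
        popular-colour = choose cs R≤∑ᴸ cs≤k
          where
          choose : ∀ cs → ∑ (M ℕ.+ H) (λ d → 𝟙 (R d)) ≤ ∑ᴸ cs count → length cs ℕ.≤ k →
                   ∃ λ c → c ∈ cs × ∑ (M ℕ.+ H) (λ d → 𝟙 (R d)) ≤ + k * count c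
          -- With every colour excluded there are no roots left, against the positive lower bound
          -- `R-count`.
          choose [] R≤0 _ = ⊥-elim (<⇒≱ (0<-* {+ u} (+<+ 0<u) (+<+ 0<M))
            (≤-trans R-count (≤-trans (*-monoˡ (+ 4 * + t) (0≤-* {+ 4} {+ t} 0≤+ 0≤+) R≤0) (≤-reflexive (*-zeroʳ (+ 4 * + t))))))
          choose (c ∷ cs) R≤ len≤ with maximum c cs count
          ... | m , m∈ , le = m , m∈ , ≤-trans R≤ (≤-trans le
                  (*-monoʳ (count m) (∑-nonneg (M ℕ.+ H) (λ d _ → 0≤𝟙 (coloured m d))) (+≤+ len≤)))

        step : ∃ λ cs' → State s cs' E
        step = let c , c∈cs , popular = popular-colour in Exclude.next c c∈cs popular

      -- Finitely many starting points suffice, since a window that starts at or beyond `L` misses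
      -- B.
      dense-window? : Dec (∃ λ a → a ℕ.< L × + 3 * + u * + ℓ ≤ + 2 * + t * window a)
      dense-window? = ℕ.anyUpTo? (λ a → + 3 * + u * + ℓ ≤? + 2 * + t * window a) L

      step : ∃₂ λ cs' e' → State s cs' e'
      step with dense-window?
      ... | yes (a , _ , denser) = cs , e , increment a denser
      ... | no  none = let cs' , S' = Uniform.step uniform in cs' , E , S'
        where
        uniform : ∀ a → + 2 * + t * window a ≤ + 3 * + u * + ℓ
        uniform a with a ℕ.<? L
        ... | yes a<L = <⇒≤ (≰⇒> (λ le → none (a , a<L , le)))
        ... | no  a≮L = begin
          + 2 * + t * window a   ≡⟨ cong (+ 2 * + t *_) (∑-zero ℓ (λ i _ → cong 𝟙 (trans (cong B (index i)) (support _)))) ⟩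
          + 2 * + t * 0ℤ         ≡⟨ *-zeroʳ (+ 2 * + t) ⟩
          0ℤ                     ≤⟨ 0≤-* {+ 3 * + u} {+ ℓ} (0≤-* {+ 3} {+ u} 0≤+ 0≤+) 0≤+ ⟩
          + 3 * + u * + ℓ        ∎
          where
          open ≤-Reasoning
          index : ∀ i → V ℕ.* i ℕ.+ a ≡ L ℕ.+ (V ℕ.* i ℕ.+ (a ℕ.∸ L))
          index i = trans (cong (V ℕ.* i ℕ.+_) (sym (ℕ.m+[n∸m]≡n (ℕ.≮⇒≥ a≮L)))) (lemma (V ℕ.* i) L (a ℕ.∸ L))
            where
            lemma : ∀ x l y → x ℕ.+ (l ℕ.+ y) ≡ l ℕ.+ (x ℕ.+ y)
            lemma = ℕ-Solver.solve-∀

    -- Each step lowers `s`. At e = 0 the invariant says t < u, a density above 1; at s = 0 with e >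
    -- 0 the fuel inequality fails.
    no-state : ∀ s cs e → State s cs e → ⊥
    no-state s cs zero S = ℕ.<⇒≱ (subst₂ ℕ._<_ (ℕ.+-identityʳ t) (ℕ.+-identityʳ u) increments) u≤t
      where open State S
    no-state zero cs (suc e) S = ℕ.<⇒≱ (s≤s z≤n) (ℕ.≤-trans (ℕ.m≤n+m (suc e) (length cs ℕ.* suc E)) fuel)
      where open State S
    no-state (suc s) cs (suc e) S = let cs' , e' , S' = Step.step S in no-state s cs' e' S'

-- Size estimates and the choice of parameters.

module Bounds where

  open import Data.Nat.Base
  open import Data.Nat.Properties
  open import Data.Nat.Tactic.RingSolver using (solve-∀)
  open import Relation.Binary.PropositionalEquality
  open VanDerCorput using (square)
  open Descent using (nextInverseDensity; finalInverseDensity; shifts; dilation; previousLength; requiredLength)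

  open ≤-Reasoning

  n<2^n : ∀ n → n < 2 ^ n
  n<2^n zero    = s≤s z≤n
  n<2^n (suc n) = begin
    suc (suc n)        ≤⟨ +-mono-≤ (m^n>0 2 n) (n<2^n n) ⟩
    2 ^ n + 2 ^ n      ≡⟨ cong (2 ^ n +_) (+-identityʳ (2 ^ n)) ⟨
    2 ^ suc n          ∎

  2^-mono : ∀ {m n} → m ≤ n → 2 ^ m ≤ 2 ^ n
  2^-mono = ^-monoʳ-≤ 2

  *-≤2^ : ∀ {a b} i j → a ≤ 2 ^ i → b ≤ 2 ^ j → a * b ≤ 2 ^ (i + j)
  *-≤2^ i j a≤ b≤ = ≤-trans (*-mono-≤ a≤ b≤) (≤-reflexive (sym (^-distribˡ-+-* 2 i j)))

  m!≤n^m : ∀ {m n} → m ≤ n → m ! ≤ n ^ m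
  m!≤n^m {zero}  _   = s≤s z≤n
  m!≤n^m {suc m} m<n = *-mono-≤ m<n (m!≤n^m (<⇒≤ m<n))

  -- In exponents one exclusion is a ↦ 2a + b, which doubles a + b.
  finalInverseDensity-≤ : ∀ k b r {K} a → 16 * k ≤ 2 ^ b → K ≤ 2 ^ a →
                          finalInverseDensity k r K ≤ 2 ^ (2 ^ r * (a + b))
  finalInverseDensity-≤ k b zero {K} a _ K≤ = ≤-trans K≤ (2^-mono (begin
    a                ≤⟨ m≤m+n a b ⟩
    a + b            ≡⟨ +-identityʳ (a + b) ⟨
    2 ^ 0 * (a + b)  ∎))
  finalInverseDensity-≤ k b (suc r) {K} a k≤ K≤ = begin
    finalInverseDensity k r (nextInverseDensity k K)
      ≤⟨ finalInverseDensity-≤ k b r (b + (a + a)) k≤ (*-≤2^ b (a + a) k≤ (*-≤2^ a a K≤ K≤)) ⟩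
    2 ^ (2 ^ r * (b + (a + a) + b))
      ≡⟨ cong (2 ^_) (lemma (2 ^ r) a b) ⟩
    2 ^ (2 ^ suc r * (a + b)) ∎
    where
    lemma : ∀ p a b → p * (b + (a + a) + b) ≡ 2 * p * (a + b)
    lemma = solve-∀

  module _ (K A : ℕ) (K≤ : K ≤ 2 ^ A) (0<K : 0 < K) where

    h W : ℕ
    h = 3 + A + (3 + A)
    W = h + h

    shifts-≤ : shifts K ≤ 2 ^ h
    shifts-≤ = *-≤2^ (3 + A) (3 + A) 8K≤ 8K≤
      where
      8K≤ : 8 * K ≤ 2 ^ (3 + A)
      8K≤ = *-≤2^ 3 A ≤-refl K≤

    0<shifts : 0 < shifts K
    0<shifts = *-mono-≤ 0<8K 0<8K
      where
      0<8K : 0 < 8 * K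
      0<8K = *-mono-≤ {1} {8} (s≤s z≤n) 0<K

    0<dilation : 0 < dilation K
    0<dilation = *-mono-≤ {1} {2} (s≤s z≤n) (1≤n! (shifts K))

    dilation-≤ : dilation K ≤ 2 ^ (2 ^ W)
    dilation-≤ = begin
      2 * shifts K !           ≤⟨ *-≤2^ 1 (h * 2 ^ h) ≤-refl factorial ⟩
      2 ^ (1 + h * 2 ^ h)      ≤⟨ 2^-mono (+-monoˡ-≤ (h * 2 ^ h) (m^n>0 2 h)) ⟩
      2 ^ (suc h * 2 ^ h)      ≤⟨ 2^-mono (*-≤2^ h h (n<2^n h) ≤-refl) ⟩
      2 ^ (2 ^ W)              ∎
      where
      factorial : shifts K ! ≤ 2 ^ (h * 2 ^ h)
      factorial = begin
        shifts K !               ≤⟨ m!≤n^m {shifts K} ≤-refl ⟩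
        shifts K ^ shifts K      ≤⟨ ^-monoˡ-≤ (shifts K) shifts-≤ ⟩
        (2 ^ h) ^ shifts K       ≡⟨ ^-*-assoc 2 h (shifts K) ⟩
        2 ^ (h * shifts K)       ≤⟨ 2^-mono (*-monoʳ-≤ h shifts-≤) ⟩
        2 ^ (h * 2 ^ h)          ∎

    module _ (Q c : ℕ) (Q≤ : Q ≤ 2 ^ c) (0<Q : 0 < Q) where

      g : ℕ
      g = 4 + (h + (2 ^ W + 2 ^ W) + c)

      previousLength-≤ : ∀ ℓ a → 0 < ℓ → ℓ ≤ 2 ^ a → previousLength K Q ℓ ≤ 2 ^ (2 * (g + a))
      previousLength-≤ ℓ a 0<ℓ ℓ≤ = begin
        9 * (square (2 * H * V * ℓ * Q + H) + V * ℓ)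
          ≤⟨ *-monoʳ-≤ 9 (+-mono-≤ (*-mono-≤ 2y+H≤ 2y+H≤) Vℓ≤) ⟩
        9 * (3 * y * (3 * y) + y * y)
          ≡⟨ lemma₁ y ⟩
        90 * (y * y)
          -- Rounding 90 up to 16² keeps a perfect square and hence an exponent of the form 2(g +
          -- a).
          ≤⟨ *-monoˡ-≤ (y * y) (m≤m+n 90 166) ⟩
        256 * (y * y)
          ≡⟨ lemma₂ y ⟩
        16 * y * (16 * y)
          ≤⟨ *-≤2^ (4 + i) (4 + i) 16y≤ 16y≤ ⟩
        2 ^ (4 + i + (4 + i))
          ≡⟨ cong (2 ^_) (lemma₃ h (2 ^ W) a c) ⟩
        2 ^ (2 * (g + a)) ∎
        where
        H = shifts K
        V = square (dilation K)
        y = H * V * ℓ * Q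
        i = h + (2 ^ W + 2 ^ W) + a + c
        lemma₁ : ∀ y → 9 * (3 * y * (3 * y) + y * y) ≡ 90 * (y * y)
        lemma₁ = solve-∀
        lemma₂ : ∀ y → 256 * (y * y) ≡ 16 * y * (16 * y)
        lemma₂ = solve-∀
        lemma₃ : ∀ h w a c → 4 + (h + (w + w) + a + c) + (4 + (h + (w + w) + a + c)) ≡
                             2 * (4 + (h + (w + w) + c) + a)
        lemma₃ = solve-∀
        lemma₄ : ∀ H V l Q → 2 * H * V * l * Q + H * V * l * Q ≡ 3 * (H * V * l * Q)
        lemma₄ = solve-∀
        0<V : 0 < V
        0<V = *-mono-≤ 0<dilation 0<dilation
        H≤y : H ≤ y
        H≤y = ≤-trans (m≤m*n H V {{>-nonZero 0<V}})
             (≤-trans (m≤m*n (H * V) ℓ {{>-nonZero 0<ℓ}}) (m≤m*n (H * V * ℓ) Q {{>-nonZero 0<Q}}))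
        2y+H≤ : 2 * H * V * ℓ * Q + H ≤ 3 * y
        2y+H≤ = ≤-trans (+-monoʳ-≤ (2 * H * V * ℓ * Q) H≤y) (≤-reflexive (lemma₄ H V ℓ Q))
        Vℓ≤ : V * ℓ ≤ y * y
        Vℓ≤ = begin
          V * ℓ              ≤⟨ m≤n*m (V * ℓ) H {{>-nonZero 0<shifts}} ⟩
          H * (V * ℓ)        ≡⟨ *-assoc H V ℓ ⟨
          H * V * ℓ          ≤⟨ m≤m*n (H * V * ℓ) Q {{>-nonZero 0<Q}} ⟩
          y                  ≤⟨ m≤m*n y y {{>-nonZero (≤-trans 0<shifts H≤y)}} ⟩
          y * y              ∎
        16y≤ : 16 * y ≤ 2 ^ (4 + i)
        16y≤ = *-≤2^ {16} 4 i ≤-refl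
          (*-≤2^ (h + (2 ^ W + 2 ^ W) + a) c
            (*-≤2^ (h + (2 ^ W + 2 ^ W)) a
              (*-≤2^ h (2 ^ W + 2 ^ W) shifts-≤ (*-≤2^ (2 ^ W) (2 ^ W) dilation-≤ dilation-≤)) ℓ≤) Q≤)

      0<previousLength : ∀ ℓ → 0 < previousLength K Q ℓ
      0<previousLength ℓ = *-mono-≤ {1} {9} (s≤s z≤n) (≤-trans (*-mono-≤ le le) (m≤m+n _ _))
        where
        le : 1 ≤ 2 * shifts K * square (dilation K) * ℓ * Q + shifts K
        le = ≤-trans 0<shifts (m≤n+m (shifts K) _)

      0<requiredLength : ∀ s → 0 < requiredLength K Q s
      0<requiredLength zero    = s≤s z≤n
      0<requiredLength (suc s) = 0<previousLength (requiredLength K Q s)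

      logLength : ℕ → ℕ
      logLength zero    = 0
      logLength (suc s) = 2 * (g + logLength s)

      -- The recursion a ↦ 2(g + a) has fixed point -2g, so the distance from it doubles at each
      -- step.
      logLength-≡ : ∀ s → logLength s + 2 * g ≡ g * 2 ^ suc s
      logLength-≡ zero    = *-comm 2 g
      logLength-≡ (suc s) = begin-equality
        2 * (g + logLength s) + 2 * g   ≡⟨ lemma g (logLength s) ⟩
        2 * (logLength s + 2 * g)       ≡⟨ cong (2 *_) (logLength-≡ s) ⟩
        2 * (g * 2 ^ suc s)             ≡⟨ lemma' g (2 ^ suc s) ⟩
        g * 2 ^ suc (suc s)             ∎
        where
        lemma : ∀ g l → 2 * (g + l) + 2 * g ≡ 2 * (l + 2 * g)
        lemma = solve-∀
        lemma' : ∀ g p → 2 * (g * p) ≡ g * (2 * p)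
        lemma' = solve-∀

      requiredLength-≤ : ∀ s → requiredLength K Q s ≤ 2 ^ logLength s
      requiredLength-≤ zero    = ≤-refl
      requiredLength-≤ (suc s) = previousLength-≤ _ (logLength s) (0<requiredLength s) (requiredLength-≤ s)

    -- Q = w^s because `q` starts at 1 and gains a factor `w` at most `s` times.
    requiredLength-≤2^2^ : ∀ s →
      requiredLength K (dilation K ^ s) s ≤ 2 ^ (2 ^ (W + (s + 4) + suc s))
    requiredLength-≤2^2^ s = begin
      requiredLength K (dilation K ^ s) s   ≤⟨ requiredLength-≤ Q c Q≤ 0<Q s ⟩
      2 ^ logLength Q c Q≤ 0<Q s            ≤⟨ 2^-mono (m+n≤o⇒m≤o (logLength Q c Q≤ 0<Q s) (≤-reflexive (logLength-≡ Q c Q≤ 0<Q s))) ⟩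
      2 ^ (g Q c Q≤ 0<Q * 2 ^ suc s)        ≤⟨ 2^-mono (*-≤2^ (W + (s + 4)) (suc s) g≤ ≤-refl) ⟩
      2 ^ (2 ^ (W + (s + 4) + suc s))       ∎
      where
      Q c : ℕ
      Q = dilation K ^ s
      c = 2 ^ W * s
      Q≤ : Q ≤ 2 ^ c
      Q≤ = ≤-trans (^-monoˡ-≤ s dilation-≤) (≤-reflexive (^-*-assoc 2 (2 ^ W) s))
      0<Q : 0 < Q
      0<Q = m^n>0 (dilation K) {{>-nonZero 0<dilation}} s
      p = 2 ^ W
      4+h≤p+p : 4 + h ≤ p + p
      4+h≤p+p = +-mono-≤ 4≤p (≤-trans (m≤m+n h h) (<⇒≤ (n<2^n W)))
        where
        4≤p : 4 ≤ p
        4≤p = 2^-mono {2} (≤-trans (s≤s (s≤s z≤n)) (m≤m+n h h))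
      g≤ : g Q c Q≤ 0<Q ≤ 2 ^ (W + (s + 4))
      g≤ = begin
        4 + (h + (p + p) + p * s)      ≡⟨ lemma₁ h p s ⟩
        4 + h + (p + p + p * s)        ≤⟨ +-monoˡ-≤ (p + p + p * s) 4+h≤p+p ⟩
        p + p + (p + p + p * s)        ≡⟨ lemma₂ p s ⟩
        p * (s + 4)                    ≤⟨ *-≤2^ W (s + 4) ≤-refl (<⇒≤ (n<2^n (s + 4))) ⟩
        2 ^ (W + (s + 4))              ∎
        where
        lemma₁ : ∀ h p s → 4 + (h + (p + p) + p * s) ≡ 4 + h + (p + p + p * s)
        lemma₁ = solve-∀
        lemma₂ : ∀ p s → p + p + (p + p + p * s) ≡ p * (s + 4)
        lemma₂ = solve-∀

  module Choice (k : ℕ) (0<k : 0 < k) where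

    -- From density 1, `k` exclusions give inverse density at most 2^(2^k(4 + k)), and 2^k(4 + k) ≤
    -- 2^(4k) = A. Since (3/2)^(2A) = (9/4)^A > 2^A = K, the value E = 2A bounds the increments
    -- between exclusions. The sum `s` is the fuel for `k` colours together with `E` initial
    -- increments.
    A K E s : ℕ
    A = 2 ^ (4 * k)
    K = 2 ^ A
    E = 2 * A
    s = k * suc E + E

    0<A : 0 < A
    0<A = m^n>0 2 (4 * k)

    0<K : 0 < K
    0<K = m^n>0 2 A

    finalInverseDensity≤K : finalInverseDensity k k 1 ≤ K
    finalInverseDensity≤K = ≤-trans
      (finalInverseDensity-≤ k (4 + k) k 0 (*-≤2^ {16} 4 k ≤-refl (<⇒≤ (n<2^n k))) ≤-refl)
      (2^-mono (≤-trans (*-≤2^ {2 ^ k} k (2 + k) ≤-refl 4+k≤) (2^-mono exponent)))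
      where
      4+k≤ : 4 + k ≤ 2 ^ (2 + k)
      4+k≤ = ≤-trans (+-monoʳ-≤ 4 (m≤n*m k 4))
        (≤-trans (≤-reflexive (lemma k)) (*-≤2^ {4} 2 k ≤-refl (n<2^n k)))
        where
        lemma : ∀ k → 4 + 4 * k ≡ 4 * (1 + k)
        lemma = solve-∀
      exponent : k + (2 + k) ≤ 4 * k
      exponent = ≤-trans (+-monoʳ-≤ k (+-monoˡ-≤ k (*-monoʳ-≤ 2 0<k))) (≤-reflexive (lemma k))
        where
        lemma : ∀ k → k + (2 * k + k) ≡ 4 * k
        lemma = solve-∀

    E-large : 2 ^ E * K < 3 ^ E
    E-large = subst₂ _<_ eight nine (^-monoˡ-< A {{>-nonZero 0<A}} (n<1+n 8))
      where
      nine : 9 ^ A ≡ 3 ^ E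
      nine = ^-*-assoc 3 2 A
      eight : 8 ^ A ≡ 2 ^ E * K
      eight = begin-equality
        8 ^ A              ≡⟨ ^-*-assoc 2 3 A ⟩
        2 ^ (3 * A)        ≡⟨ cong (2 ^_) (lemma A) ⟩
        2 ^ (2 * A + A)    ≡⟨ ^-distribˡ-+-* 2 (2 * A) A ⟩
        2 ^ E * K          ∎
        where
        lemma : ∀ A → 3 * A ≡ 2 * A + A
        lemma = solve-∀

    -- The exponent is at most 31A² ≤ 2^(5 + 8k), and 5 ≤ 5k gives the constant 13.
    requiredLength-bound : requiredLength K (dilation K ^ s) s ≤ 2 ^ (2 ^ (2 ^ (13 * k)))
    requiredLength-bound = ≤-trans (requiredLength-≤2^2^ K A ≤-refl 0<K s) (2^-mono (2^-mono (begin
      W K A ≤-refl 0<K + (s + 4) + suc s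
        ≡⟨ lemma₁ A s ⟩
      17 + 4 * A + 2 * s
        ≤⟨ +-mono-≤ (+-mono-≤ (*-monoʳ-≤ 17 (*-mono-≤ 0<A 0<A)) (*-monoʳ-≤ 4 A≤A²)) (*-monoʳ-≤ 2 s≤) ⟩
      17 * (A * A) + 4 * (A * A) + 2 * (5 * (A * A))
        ≡⟨ lemma₂ (A * A) ⟩
      31 * (A * A)
        ≤⟨ *-≤2^ {31} 5 (4 * k + 4 * k) (n≤1+n 31) (*-≤2^ (4 * k) (4 * k) ≤-refl ≤-refl) ⟩
      2 ^ (5 + (4 * k + 4 * k))
        ≤⟨ 2^-mono (≤-trans (+-monoˡ-≤ (4 * k + 4 * k) (*-monoʳ-≤ 5 0<k)) (≤-reflexive (lemma₃ k))) ⟩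
      2 ^ (13 * k) ∎)))
      where
      A≤A² : A ≤ A * A
      A≤A² = m≤m*n A A {{>-nonZero 0<A}}
      k≤A : k ≤ A
      k≤A = ≤-trans (m≤n*m k 4) (<⇒≤ (n<2^n (4 * k)))
      s≤ : s ≤ 5 * (A * A)
      s≤ = begin
        k * suc (2 * A) + 2 * A            ≤⟨ +-mono-≤ (*-mono-≤ k≤A (+-monoˡ-≤ (2 * A) 0<A)) (*-monoʳ-≤ 2 A≤A²) ⟩
        A * (A + 2 * A) + 2 * (A * A)      ≡⟨ lemma A ⟩
        5 * (A * A)                        ∎
        where
        lemma : ∀ A → A * (A + 2 * A) + 2 * (A * A) ≡ 5 * (A * A)
        lemma = solve-∀
      lemma₁ : ∀ A s → 3 + A + (3 + A) + (3 + A + (3 + A)) + (s + 4) + (1 + s) ≡ 17 + 4 * A + 2 * s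
      lemma₁ = solve-∀
      lemma₂ : ∀ x → 17 * x + 4 * x + 2 * (5 * x) ≡ 31 * x
      lemma₂ = solve-∀
      lemma₃ : ∀ k → 5 * k + (4 * k + 4 * k) ≡ 13 * k
      lemma₃ = solve-∀

-- From a colouring of {1,...,N} to the initial state.

module Extension where

  open import Data.Nat.Base
  open import Data.Nat.Properties
  open import Data.Bool.Base using (true)
  open import Data.Empty using (⊥)
  open import Data.Fin.Base using (Fin; zero; fromℕ<; toℕ)
  open import Data.Fin.Properties using (toℕ-fromℕ<; fromℕ<-toℕ; toℕ<n)
  open import Data.Integer.Base as ℤ using (+_)
  import Data.Integer.Properties as ℤ
  open import Data.List.Base using (allFin; length)
  open import Data.List.Properties using (length-tabulate)
  open import Data.List.Membership.Propositional.Properties using (∈-allFin)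
  open import Data.Product using (∃; _,_)
  open import Data.Sum using (inj₁)
  open import Relation.Nullary using (¬_; yes; no; contradiction)
  open import Relation.Binary.PropositionalEquality
  open FiniteSums
  open Indicators
  open VanDerCorput using (square)
  open Descent using (dilation; requiredLength; no-state)
  open Bounds using (module Choice)

  module _ {k N : ℕ} (c : Colouring (suc k) N) where

    -- The colour at 0 and beyond `N` is a dummy: the descent applies the avoidance hypothesis only
    -- to positive numbers up to `N`.
    extend : ℕ → Fin (suc k)
    extend zero = zero
    extend (suc m) with m <? N
    ... | yes m<N = c (fromℕ< m<N)
    ... | no  _   = zero

    extend-elt : ∀ i → extend (elt i) ≡ c i
    extend-elt i with toℕ i <? N
    ... | yes i<N = cong c (fromℕ<-toℕ i i<N)
    ... | no  i≮N = contradiction (toℕ<n i) i≮N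

    position : ∀ {y} → 0 < y → y ≤ N → ∃ λ (i : Fin N) → elt i ≡ y
    position {suc y} _ y<N = fromℕ< y<N , cong suc (toℕ-fromℕ< y<N)

    extend-avoids : NoMonoSquareDiff c → ∀ y z → 0 < y → 0 < z → y + square z ≤ N →
                    extend (y + square z) ≡ extend y → extend y ≡ extend z → ⊥
    extend-avoids avoids y z 0<y 0<z ≤N χx≡χy χy≡χz
      with position (≤-trans 0<y (m≤m+n y _)) ≤N
         | position 0<y (≤-trans (m≤m+n y _) ≤N)
         | position 0<z (≤-trans (m≤m*n z z {{>-nonZero 0<z}}) (≤-trans (m≤n+m _ y) ≤N))
    ... | x , x≡ | y' , y≡ | z' , z≡ = avoids x y' z'
      (trans x≡ (sym (cong₂ (λ a b → a + square b) y≡ z≡)))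
      (trans (colour x x≡) (trans χx≡χy (sym (colour y' y≡))))
      (trans (colour y' y≡) (trans χy≡χz (sym (colour z' z≡))))
      where
      colour : ∀ i {n} → elt i ≡ n → c i ≡ extend n
      colour i eq = trans (sym (extend-elt i)) (cong extend eq)

    -- The descent starts from the full interval with q = 1, density 1 and no colour excluded.
    short : NoMonoSquareDiff c →
            let open Choice (suc k) (s≤s z≤n) in ¬ (requiredLength K (dilation K ^ s) s ≤ N)
    short avoids long = no-state (suc k) N (s≤s z≤n) extend (extend-avoids avoids) K E (dilation K ^ s) 0<K E-large
      s (allFin (suc k)) E record
        { q = 1 ; L = N ; K = 1 ; t = 1 ; u = 1
        ; B = everything
        ; 0<q = s≤s z≤n
        ; 0<t = s≤s z≤n
        ; 0<u = s≤s z≤n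
        ; inside = ≤-reflexive (*-identityˡ N)
        ; support = truncate-high N (λ _ → true)
        ; dense = ℤ.≤-reflexive (cong (λ e → + 1 ℤ.* e) (sym (trans (∑-truncate N (λ _ → true)) (trans (∑-const N (+ 1)) (ℤ.*-identityʳ (+ N))))))
        ; t≤Ku = ≤-refl
        ; increments = subst₂ _<_ (sym (*-identityʳ (2 ^ E))) (sym (*-identityʳ (3 ^ E)))
            (≤-<-trans (m≤m*n (2 ^ E) K {{>-nonZero 0<K}}) E-large)
        ; K-bound = subst (λ r → finalInverseDensity (suc k) r 1 ≤ K) (sym length≡) finalInverseDensity≤K
        ; colours = λ a → inj₁ (∈-allFin a)
        ; cs≤k = ≤-reflexive length≡
        ; long = long
        ; fine = ≤-reflexive (*-identityˡ _)
        ; fuel = ≤-reflexive (cong (λ r → r * suc E + E) length≡)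
        }
      where
      open Choice (suc k) (s≤s z≤n)
      open Descent using (finalInverseDensity)
      everything : ℕ → _
      everything = truncate N (λ _ → true)
      length≡ : length (allFin (suc k)) ≡ suc k
      length≡ = length-tabulate (λ i → i)

import Data.Fin.Base as Fin
open import Data.Nat using (ℕ; zero; suc; _*_; _^_; _≤_; _<_; z≤n; s≤s)
open import Data.Nat.Properties using (≤-total; ≤-trans)
open import Data.Product using (Σ; _×_; _,_)
open import Data.Sum using (inj₁; inj₂)
open import Relation.Nullary using (contradiction)

theorem1p1 : Σ ℕ (λ C → (0 < C) ×
    ((k N : ℕ) (c : Colouring k N) → NoMonoSquareDiff c →
    N ≤ 2 ^ (2 ^ (2 ^ (C * k)))))
theorem1p1 = 13 , s≤s z≤n , bound
  where
  bound : (k N : ℕ) (c : Colouring k N) → NoMonoSquareDiff c → N ≤ 2 ^ (2 ^ (2 ^ (13 * k)))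
  bound zero    zero    c avoids = z≤n
  bound zero    (suc N) c avoids with c Fin.zero
  ... | ()
  bound (suc k) N       c avoids with ≤-total N (2 ^ (2 ^ (2 ^ (13 * suc k))))
  ... | inj₁ N≤ = N≤
  -- An `N` this large would leave room for all `s` steps of the descent.
  ... | inj₂ ≤N = contradiction (≤-trans (Bounds.Choice.requiredLength-bound (suc k) (s≤s z≤n)) ≤N)
                                (Extension.short c avoids)
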